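{- Define sequences $(a_k)_{k\ge1}$ and $(c_k)_{k\ge 1}$ by $a_1=4$, $c_1=6$ and, for $k\ge 2$, $$a_k=a_{k-1}+2c_{k-1},\qquad c_k=a_{k-1}+4c_{k-1}.$$ Let $T$ be a rooted tree that is a unit rectangle visibility graph. Then for every $k\ge 1$ the number of vertices of $T$ at depth $k$ is at most $c_k$. Furthermore, this bound is tight: for every $k\ge 1$ there is a rooted tree that is a unit rectangle visibility graph and has exactly $c_k$ vertices at depth $k$.
   Context: The depth of a vertex in a rooted tree is its distance from the root. A finite simple graph $G$ is a unit rectangle visibility graph (URVG) if its vertices $v$ can be represented by closed unit squares $S_v$ in the plane with sides parallel to the coordinate axes and with pairwise disjoint interiors (squares may touch along their boundaries), in such a way that two distinct vertices $v,w$ are adjacent if and only if there is an unobstructed non-degenerate (positive width) horizontal or vertical band of visibility joining $S_v$ and $S_w$. Here a horizontal band of visibility joining $S_v$ and $S_w$ is given by an open interval $I$ of positive length such that for every $y_0\in I$ the line $y=y_0$ meets the interiors of both $S_v$ and $S_w$, and the part of this line between $S_v$ and $S_w$ (possibly a single point if the squares touch) meets the interior of no other square of the representation; vertical bands are defined analogously with the roles of $x$ and $y$ exchanged. -}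

module Defs where

open import Level using (0ℓ)
open import Data.Nat as ℕ using (ℕ; zero; suc)
import Data.Nat.Properties as ℕ
open import Data.Fin using (Fin; zero; suc; inject₁; fromℕ)
import Data.Fin.Properties as Fin
open import Data.List using (length; filter; allFin)
open import Data.Product using (∃; ∃₂; _×_; _,_; swap)
open import Data.Rational as ℚ using (ℚ; 1ℚ)
import Data.Rational.Properties as ℚ
open import Data.Sum using (_⊎_)
open import Function using (_∘_; _⇔_; mk⇔; Equivalence; Injective)
open import Relation.Binary
  using (Rel; Decidable; Symmetric; Irreflexive)
open import Relation.Binary.PropositionalEquality
  using (_≡_; _≢_; refl; sym; subst)
open import Relation.Nullary using (¬_; Dec; ¬?; _×-dec_)
open import Algebra.Properties.Group ℚ.+-0-group
  using (//-rightDividesˡ; //-rightDividesʳ)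

-- Real numbers, as two-sided located Dedekind cuts of ℚ.

record ℝ : Set₁ where
  field
    L U         : ℚ → Set
    L-inhabited : ∃ L
    U-inhabited : ∃ U
    L-rounded   : ∀ q → L q ⇔ (∃ λ r → q ℚ.< r × L r)
    U-rounded   : ∀ q → U q ⇔ (∃ λ r → r ℚ.< q × U r)
    disjoint    : ∀ q → ¬ (L q × U q)
    located     : ∀ {q r} → q ℚ.< r → L q ⊎ U r

infix 4 _<ℝ_ _≤ℝ_

_<ℝ_ : ℝ → ℝ → Set
x <ℝ y = ∃ λ q → ℝ.U x q × ℝ.L y q

_≤ℝ_ : ℝ → ℝ → Set
x ≤ℝ y = ¬ (y <ℝ x)

infixl 6 _+ℚ_

_+ℚ_ : ℝ → ℚ → ℝ
x +ℚ p = record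
  { L           = λ q → X.L (q ℚ.- p)
  ; U           = λ q → X.U (q ℚ.- p)
  ; L-inhabited = let (q , l) = X.L-inhabited in q ℚ.+ p , back X.L q l
  ; U-inhabited = let (q , u) = X.U-inhabited in q ℚ.+ p , back X.U q u
  ; L-rounded   = λ q → mk⇔
      (λ l → let (r , q<r , l′) = Equivalence.to (X.L-rounded (q ℚ.- p)) l
             in r ℚ.+ p
              , subst (ℚ._< r ℚ.+ p) (//-rightDividesˡ p q) (ℚ.+-monoˡ-< p q<r)
              , back X.L r l′)
      (λ (r , q<r , l) → Equivalence.from (X.L-rounded (q ℚ.- p))
         (r ℚ.- p , ℚ.+-monoˡ-< (ℚ.- p) q<r , l))
  ; U-rounded   = λ q → mk⇔
      (λ u → let (r , r<q , u′) = Equivalence.to (X.U-rounded (q ℚ.- p)) u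
             in r ℚ.+ p
              , subst (r ℚ.+ p ℚ.<_) (//-rightDividesˡ p q) (ℚ.+-monoˡ-< p r<q)
              , back X.U r u′)
      (λ (r , r<q , u) → Equivalence.from (X.U-rounded (q ℚ.- p))
         (r ℚ.- p , ℚ.+-monoˡ-< (ℚ.- p) r<q , u))
  ; disjoint    = λ q → X.disjoint (q ℚ.- p)
  ; located     = λ q<r → X.located (ℚ.+-monoˡ-< (ℚ.- p) q<r)
  }
  where
  module X = ℝ x
  back : (P : ℚ → Set) → ∀ q → P q → P (q ℚ.+ p ℚ.- p)
  back P q = subst P (sym (//-rightDividesʳ p q))

Point : Set₁
Point = ℝ × ℝ

record Graph : Set₁ where
  infix 4 _~_ _~?_
  field
    order  : ℕ
    _~_    : Rel (Fin order) 0ℓ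
    _~?_   : Decidable _~_
    ~-sym  : Symmetric _~_
    ~-irr  : Irreflexive _≡_ _~_

  V : Set
  V = Fin order

  Walk : ℕ → V → V → Set
  Walk zero    u v = u ≡ v
  Walk (suc k) u v = ∃ λ w → u ~ w × Walk k w v

  walk? : ∀ k u v → Dec (Walk k u v)
  walk? zero    u v = u Fin.≟ v
  walk? (suc k) u v = Fin.any? λ w → (u ~? w) ×-dec walk? k w v

  IsDistance : V → V → ℕ → Set
  IsDistance u v k = Walk k u v × (∀ {j} → j ℕ.< k → ¬ Walk j u v)

  isDistance? : ∀ u v k → Dec (IsDistance u v k)
  isDistance? u v k =
    walk? k u v ×-dec ℕ.allUpTo? (λ j → ¬? (walk? j u v)) k

  Connected : Set
  Connected = ∀ u v → ∃ λ k → Walk k u v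

  -- A cycle on 3 + m distinct vertices.
  record Cycle (m : ℕ) : Set where
    field
      vertex   : Fin (3 ℕ.+ m) → V
      distinct : Injective _≡_ _≡_ vertex
      step     : ∀ (i : Fin (2 ℕ.+ m)) → vertex (inject₁ i) ~ vertex (suc i)
      close    : vertex (fromℕ (2 ℕ.+ m)) ~ vertex zero

  Acyclic : Set
  Acyclic = ∀ m → ¬ Cycle m

record RootedTree : Set₁ where
  field
    graph     : Graph
  open Graph graph public
  field
    root      : V
    connected : Connected
    acyclic   : Acyclic

  #atDepth : ℕ → ℕ
  #atDepth k = length (filter (λ v → isDistance? root v k) (allFin order))

-- The unit square [x , x + 1] × [y , y + 1] is given by its corner (x , y).

Interior : Point → Point → Set
Interior (x , y) (p , q) =
  (x <ℝ p × p <ℝ x +ℚ 1ℚ) × (y <ℝ q × q <ℝ y +ℚ 1ℚ)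

-- On a horizontal line meeting the interiors of both squares, these are the
-- abscissae of the closed segment from one square to the other, whichever of
-- the two lies on the left.
Between : Point → Point → ℝ → Set
Between (x , _) (x′ , _) p =
  (x +ℚ 1ℚ ≤ℝ p × p ≤ℝ x′) ⊎ (x′ +ℚ 1ℚ ≤ℝ p × p ≤ℝ x)

module _ {n : ℕ} where

  InteriorsDisjoint : (Fin n → Point) → Set₁
  InteriorsDisjoint S =
    ∀ v w → v ≢ w → ∀ p → ¬ (Interior (S v) p × Interior (S w) p)

  HorizontalBand : (Fin n → Point) → Fin n → Fin n → Set₁
  HorizontalBand S v w = ∃₂ λ a b → a <ℝ b ×
    (∀ y₀ → a <ℝ y₀ → y₀ <ℝ b →
      (∃ λ p → Interior (S v) (p , y₀)) ×
      (∃ λ p → Interior (S w) (p , y₀)) ×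
      (∀ p → Between (S v) (S w) p →
       ∀ u → u ≢ v → u ≢ w → ¬ Interior (S u) (p , y₀)))

  VerticalBand : (Fin n → Point) → Fin n → Fin n → Set₁
  VerticalBand S = HorizontalBand (swap ∘ S)

record IsURVG (G : Graph) : Set₁ where
  open Graph G
  field
    square   : V → Point
    disjoint : InteriorsDisjoint square
    adjacent : ∀ v w → v ≢ w →
      (v ~ w) ⇔ (HorizontalBand square v w ⊎ VerticalBand square v w)

-- The sequences start at index 1; the value 0 at index 0 is a placeholder.
mutual
  a : ℕ → ℕ
  a 0             = 0
  a 1             = 4
  a (suc (suc k)) = a (suc k) ℕ.+ 2 ℕ.* c (suc k)

  c : ℕ → ℕ
  c 0             = 0
  c 1             = 6
  c (suc (suc k)) = a (suc k) ℕ.+ 4 ℕ.* c (suc k)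

{-# OPTIONS --safe #-}
module Submission where

-- Upper bound.  Call two neighbours of a square on the same side of it a fork.  Overlapping
-- squares are joined by a path along a line, so acyclicity forbids the two prongs to overlap, and
-- it forces every square on the other side of a fork to lie at exactly the height of the fork.
-- Hence the squares joined along one axis form a subdivided caterpillar of maximum degree 3 whose
-- legs are straight.  Counting non-backtracking walks by the type of their edges gives the
-- recursion for c.
--
-- Tightness.  Grow the full tree of this shape by placing each new square, in the direction of its
-- parent edge, farther out than everything placed before.  Along a leg the direction is kept and
-- the height is that of the parent; along a spine the direction alternates and the height moves
-- by one half.  Then the parent hides all the rest of the row from the new square.

open import Defs
open import Data.Empty using (⊥; ⊥-elim)
open import Data.Fin as Fin using (Fin; zero; suc; inject₁)
open import Data.Fin.Induction using (<-weakInduction)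
import Data.Fin.Properties as Fin
open import Data.Integer as ℤ using (ℤ; +_; -[1+_]; +≤+; +<+)
import Data.Integer.Properties as ℤ
open import Data.Integer.Tactic.RingSolver using () renaming (solve-∀ to solveℤ-∀)
open import Data.List using (List; []; _∷_; _++_; length; filter; allFin; map; concatMap; lookup)
import Data.List.Membership.DecPropositional as DecMembership
open import Data.List.Membership.Propositional using (_∈_)
open import Data.List.Membership.Propositional.Properties
  using (∈-++⁻; ∈-++⁺ˡ; ∈-++⁺ʳ; ∈-map⁺; ∈-map⁻; ∈-concatMap⁻; ∈-lookup; ∈-filter⁺; ∈-filter⁻; ∈-allFin; ∈-∃++)
open import Data.List.Properties using (length-++; length-map; ≡-dec; ∷-injectiveˡ; ∷-injectiveʳ)
open import Data.List.Relation.Unary.All as All using (All; []; _∷_)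
open import Data.List.Relation.Unary.AllPairs using ([]; _∷_)
open import Data.List.Relation.Unary.Any using (Any; here; there; index)
open import Data.List.Relation.Unary.Any.Properties using (lookup-index)
open import Data.List.Relation.Unary.Unique.Propositional using (Unique)
import Data.List.Relation.Unary.Unique.Propositional.Properties as Unique
open import Data.Nat as ℕ using (ℕ; zero; suc; _+_; _*_; _≤_; _≥_; z≤n; s≤s)
open import Data.Nat.DivMod using (_%_; [m+kn]%n≡m%n)
import Data.Nat.Properties as ℕ
open import Data.Nat.Tactic.RingSolver using (solve-∀)
open import Data.Product using (Σ; ∃; ∃₂; _×_; _,_; proj₁; proj₂; swap)
open import Data.Product.Properties using () renaming (≡-dec to ×-≡-dec)
open import Data.Rational as ℚ using (ℚ; 0ℚ; 1ℚ)
import Data.Rational.Properties as ℚ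
open import Algebra.Properties.Group ℚ.+-0-group using (//-rightDividesˡ; //-rightDividesʳ)
import Data.Rational.Unnormalised as ℚᵘ
import Data.Rational.Unnormalised.Properties as ℚᵘ
open import Data.Sum as Sum using (_⊎_; inj₁; inj₂; [_,_]′)
open import Data.Unit using (⊤; tt)
open import Data.Vec as Vec using (Vec; []; _∷_)
import Data.Vec.Membership.DecPropositional as VecMembership
open import Data.Vec.Membership.Propositional using () renaming (_∈_ to _∈ᵛ_)
open import Data.Vec.Relation.Unary.All as Allᵛ using ([]; _∷_) renaming (All to Allᵛ)
open import Data.Vec.Relation.Unary.AllPairs using ([]; _∷_)
open import Data.Vec.Relation.Unary.Any using (here; there)
open import Data.Vec.Relation.Unary.Unique.Propositional using () renaming (Unique to Uniqueᵛ)
open import Data.Vec.Relation.Unary.Unique.Propositional.Properties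
  using () renaming (lookup-injective to lookup-injectiveᵛ)
open import Function using (_∘_; mk⇔; Equivalence; _$_; id)
open import Level using (Level)
open import Relation.Binary using (tri<; tri≈; tri>; DecidableEquality)
open import Relation.Binary.PropositionalEquality
  using (_≡_; _≢_; refl; sym; trans; cong; cong₂; subst; subst₂; module ≡-Reasoning)
open import Relation.Nullary using (¬_; Dec; yes; no; _⊎-dec_)
open import Relation.Nullary.Decidable using (¬¬-excluded-middle; decidable-stable)

-- The order on cut reals is undecidable, so the geometry of the upper bound is done under double
-- negations. They disappear at the end because an inequality between natural numbers is decidable.
-- The layouts for tightness live on half-integers, where comparisons are decided outright. A bound
-- of three neighbours per axis alone would be too weak. The count closes through an exchange: an
-- edge leading straight to a fork may be worth two spine edges, but then the edge on the opposite
-- side of its starting vertex is only a leg. So the edges at a vertex along one axis never weigh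
-- more than two spines and a leg, which is what a fork and the leg behind it weigh. The sequence
-- `a` has two readings: `a (suc k)` is four times the bound for a leg edge with `k` further steps,
-- and it is also the number of vertices at depth `suc k` of the extremal tree that are reached by a
-- spine move.

-- Order and unit shift on the Dedekind reals

L-down : ∀ (x : ℝ) {q r} → q ℚ.< r → ℝ.L x r → ℝ.L x q
L-down x {q} q<r l = Equivalence.from (ℝ.L-rounded x q) (_ , q<r , l)

U-up : ∀ (x : ℝ) {q r} → q ℚ.< r → ℝ.U x q → ℝ.U x r
U-up x {r = r} q<r u = Equivalence.from (ℝ.U-rounded x r) (_ , q<r , u)

L<U : ∀ (x : ℝ) {q r} → ℝ.L x q → ℝ.U x r → q ℚ.< r
L<U x {q} {r} l u with ℚ.<-cmp q r
... | tri< q<r _ _    = q<r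
... | tri≈ _ refl _   = ⊥-elim (ℝ.disjoint x q (l , u))
... | tri> _ _ r<q    = ⊥-elim (ℝ.disjoint x r (L-down x r<q l , u))

fromℚ : ℚ → ℝ
fromℚ p = record
  { L           = ℚ._< p
  ; U           = p ℚ.<_
  ; L-inhabited = p ℚ.- 1ℚ
                , subst (p ℚ.- 1ℚ ℚ.<_) (ℚ.+-identityʳ p) (ℚ.+-monoʳ-< p -1<0)
  ; U-inhabited = p ℚ.+ 1ℚ
                , subst (ℚ._< p ℚ.+ 1ℚ) (ℚ.+-identityʳ p) (ℚ.+-monoʳ-< p 0<1)
  ; L-rounded   = λ q → mk⇔
      (λ q<p → let (r , q<r , r<p) = ℚ.<-dense q<p in r , q<r , r<p)
      (λ (r , q<r , r<p) → ℚ.<-trans q<r r<p)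
  ; U-rounded   = λ q → mk⇔
      (λ p<q → let (r , p<r , r<q) = ℚ.<-dense p<q in r , r<q , p<r)
      (λ (r , r<q , p<r) → ℚ.<-trans p<r r<q)
  ; disjoint    = λ q (q<p , p<q) → ℚ.<-irrefl refl (ℚ.<-trans q<p p<q)
  ; located     = located
  }
  where
  -1<0 : ℚ.- 1ℚ ℚ.< 0ℚ
  -1<0 = ℚ.*<* ℤ.-<+
  0<1 : 0ℚ ℚ.< 1ℚ
  0<1 = ℚ.*<* (ℤ.+<+ (ℕ.s≤s ℕ.z≤n))
  located : ∀ {q r} → q ℚ.< r → q ℚ.< p ⊎ p ℚ.< r
  located {q} {r} q<r with q ℚ.<? p
  ... | yes q<p = inj₁ q<p
  ... | no q≮p  = inj₂ (ℚ.≤-<-trans (ℚ.≮⇒≥ q≮p) q<r)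

fromℕ : ℕ → ℚ
fromℕ n = + n ℚ./ 1

fromℕ-suc : ∀ n → fromℕ (suc n) ≡ fromℕ n ℚ.+ 1ℚ
fromℕ-suc n = ℚ.toℚᵘ-injective (begin
  ℚ.toℚᵘ (fromℕ (suc n))           ≈⟨ ℚ.toℚᵘ-fromℚᵘ (ℚᵘ.mkℚᵘ (+ suc n) 0) ⟩
  ℚᵘ.mkℚᵘ (+ suc n) 0              ≈⟨ ℚᵘ.*≡* (cong (ℤ._* + 1) (ℤ.+-comm (+ 1) (+ n))) ⟩
  ℚᵘ.mkℚᵘ (+ n ℤ.+ + 1) 0          ≈⟨ ℚᵘ.*≡* (cong (λ i → (i ℤ.+ + 1) ℤ.* + 1) (sym (ℤ.*-identityʳ (+ n)))) ⟩
  ℚᵘ.mkℚᵘ (+ n) 0 ℚᵘ.+ ℚᵘ.1ℚᵘ      ≈⟨ ℚᵘ.+-congˡ ℚᵘ.1ℚᵘ (ℚᵘ.≃-sym (ℚ.toℚᵘ-fromℚᵘ (ℚᵘ.mkℚᵘ (+ n) 0))) ⟩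
  ℚ.toℚᵘ (fromℕ n) ℚᵘ.+ ℚᵘ.1ℚᵘ     ≈⟨ ℚᵘ.≃-sym (ℚ.toℚᵘ-homo-+ (fromℕ n) 1ℚ) ⟩
  ℚ.toℚᵘ (fromℕ n ℚ.+ 1ℚ)          ∎)
  where open import Relation.Binary.Reasoning.Setoid ℚᵘ.≃-setoid

archimedean : ∀ p → ∃ λ n → p ℚ.≤ fromℕ n
archimedean p = ℤ.∣ ℚ.↥ p ∣ , ℚ.toℚᵘ-cancel-≤
  (ℚᵘ.≤-respʳ-≃ (ℚᵘ.≃-sym (ℚ.toℚᵘ-fromℚᵘ (ℚᵘ.mkℚᵘ (+ ℤ.∣ ℚ.↥ p ∣) 0))) (bound p))
  where
  bound : ∀ p → ℚ.toℚᵘ p ℚᵘ.≤ ℚᵘ.mkℚᵘ (+ ℤ.∣ ℚ.↥ p ∣) 0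
  bound (ℚ.mkℚ (+ n) d _)    = ℚᵘ.*≤* (ℤ.*-monoˡ-≤-nonNeg (+ n) (ℤ.+≤+ (ℕ.s≤s ℕ.z≤n)))
  bound (ℚ.mkℚ -[1+ n ] d _) = ℚᵘ.*≤* ℤ.-≤+

infix 4 _≺_ _≼_
infix 8 _⁺

-- Opaque, so that the arguments of _≺_ and _⁺ can be inferred.
opaque
  _≺_ : ℝ → ℝ → Set
  _≺_ = _<ℝ_

  _⁺ : ℝ → ℝ
  x ⁺ = x +ℚ 1ℚ

  <ℝ→≺ : ∀ x y → x <ℝ y → x ≺ y
  <ℝ→≺ x y x<y = x<y

  ≺→<ℝ : ∀ x y → x ≺ y → x <ℝ y
  ≺→<ℝ x y x<y = x<y

  ≺-⁺→<ℝ : ∀ x y → x ≺ y ⁺ → x <ℝ y +ℚ 1ℚ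
  ≺-⁺→<ℝ x y x<y = x<y

  <ℝ→≺-⁺ : ∀ x y → x <ℝ y +ℚ 1ℚ → x ≺ y ⁺
  <ℝ→≺-⁺ x y x<y = x<y

  ≺-irrefl : ∀ {x} → ¬ (x ≺ x)
  ≺-irrefl {x} (q , u , l) = ℝ.disjoint x q (l , u)

  ≺-trans : ∀ {x y z} → x ≺ y → y ≺ z → x ≺ z
  ≺-trans {x} {y} (q , xu , yl) (r , yu , zl) = r , U-up x (L<U y yl yu) xu , zl

  ≺-cotrans : ∀ {x y} z → x ≺ y → x ≺ z ⊎ z ≺ y
  ≺-cotrans {x} {y} z (q , xu , yl) with Equivalence.to (ℝ.L-rounded y q) yl
  ... | r , q<r , yl′ with ℝ.located z q<r
  ...   | inj₁ zl = inj₁ (q , xu , zl)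
  ...   | inj₂ zu = inj₂ (r , zu , yl′)

  ⁺-mono-≺ : ∀ {x y} → x ≺ y → x ⁺ ≺ y ⁺
  ⁺-mono-≺ {x} {y} (q , xu , yl) = q ℚ.+ 1ℚ
    , subst (ℝ.U x) (sym (//-rightDividesʳ 1ℚ q)) xu
    , subst (ℝ.L y) (sym (//-rightDividesʳ 1ℚ q)) yl

  ⁺-cancel-≺ : ∀ {x y} → x ⁺ ≺ y ⁺ → x ≺ y
  ⁺-cancel-≺ (q , xu , yl) = q ℚ.- 1ℚ , xu , yl

  ≺-dense : ∀ {x y} → x ≺ y → ∃ λ z → x ≺ z × z ≺ y
  ≺-dense {x} {y} (q , xu , yl) =
    let (r , r<q , xu′) = Equivalence.to (ℝ.U-rounded x q) xu
        (s , q<s , yl′) = Equivalence.to (ℝ.L-rounded y q) yl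
    in fromℚ q , (r , xu′ , r<q) , (s , q<s , yl′)

  -- If x + 1 ≤ x then the lower cut of x would be closed under adding 1.
  x≺x⁺ : ∀ x → ¬ ¬ (x ≺ x ⁺)
  x≺x⁺ x x+1≤x =
    let (q , l) = ℝ.L-inhabited x
        (r , u) = ℝ.U-inhabited x
        (n , r-q≤n) = archimedean (r ℚ.- q)
        r≤n+q = subst (ℚ._≤ fromℕ n ℚ.+ q) (//-rightDividesˡ q r) (ℚ.+-monoˡ-≤ q r-q≤n)
    in ℚ.<-irrefl refl (ℚ.<-≤-trans (L<U x (climb l n) u) r≤n+q)
    where
    step : ∀ {q} → ℝ.L x q → ℝ.L x (q ℚ.+ 1ℚ)
    step {q} l with Equivalence.to (ℝ.L-rounded x q) l
    ... | r , q<r , l′ with ℝ.located x (ℚ.+-monoˡ-< 1ℚ q<r)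
    ...   | inj₁ l″ = l″
    ...   | inj₂ u  = ⊥-elim (x+1≤x
      (r ℚ.+ 1ℚ , u , subst (ℝ.L x) (sym (//-rightDividesʳ 1ℚ r)) l′))
    climb : ∀ {q} → ℝ.L x q → ∀ n → ℝ.L x (fromℕ n ℚ.+ q)
    climb {q} l zero    = subst (ℝ.L x) (sym (ℚ.+-identityˡ q)) l
    climb {q} l (suc n) = subst (ℝ.L x) eq (step (climb l n))
      where
      eq : fromℕ n ℚ.+ q ℚ.+ 1ℚ ≡ fromℕ (suc n) ℚ.+ q
      eq = trans (ℚ.+-assoc (fromℕ n) q 1ℚ)
          (trans (cong (fromℕ n ℚ.+_) (ℚ.+-comm q 1ℚ))
          (trans (sym (ℚ.+-assoc (fromℕ n) 1ℚ q))
                 (cong (ℚ._+ q) (sym (fromℕ-suc n)))))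

_≼_ : ℝ → ℝ → Set
x ≼ y = ¬ (y ≺ x)

≺⇒≼ : ∀ {x y} → x ≺ y → x ≼ y
≺⇒≼ x<y y<x = ≺-irrefl (≺-trans x<y y<x)

≼-≺-trans : ∀ {x y z} → x ≼ y → y ≺ z → x ≺ z
≼-≺-trans {x} x≤y y<z with ≺-cotrans x y<z
... | inj₁ y<x = ⊥-elim (x≤y y<x)
... | inj₂ x<z = x<z

≺-≼-trans : ∀ {x y z} → x ≺ y → y ≼ z → x ≺ z
≺-≼-trans {z = z} x<y y≤z with ≺-cotrans z x<y
... | inj₁ x<z = x<z
... | inj₂ z<y = ⊥-elim (y≤z z<y)

≼-trans : ∀ {x y z} → x ≼ y → y ≼ z → x ≼ z
≼-trans x≤y y≤z z<x = x≤y (≼-≺-trans y≤z z<x)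

⁺-mono-≼ : ∀ {x y} → x ≼ y → x ⁺ ≼ y ⁺
⁺-mono-≼ x≤y y⁺<x⁺ = x≤y (⁺-cancel-≺ y⁺<x⁺)

-- Paths and cycles

module GraphPaths (G : Graph) where
  open Graph G

  data Path (P : V → Set) : V → V → Set where
    one  : ∀ {t} → P t → Path P t t
    cons : ∀ {s x t} → P s → s ~ x → Path P x t → Path P s t

  map-path : ∀ {P Q : V → Set} {s t} → (∀ {u} → P u → Q u) → Path P s t → Path Q s t
  map-path f (one p)      = one (f p)
  map-path f (cons p e π) = cons (f p) e (map-path f π)

  infixr 5 _++ᵖ_

  _++ᵖ_ : ∀ {P s t u} → Path P s t → Path P t u → Path P s u
  one _      ++ᵖ ρ = ρ
  cons p e π ++ᵖ ρ = cons p e (π ++ᵖ ρ)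

  head-path : ∀ {P s t} → Path P s t → P s
  head-path (one p)      = p
  head-path (cons p _ _) = p

  last-path : ∀ {P s t} → Path P s t → P t
  last-path (one p)      = p
  last-path (cons _ _ π) = last-path π

  reverse-path : ∀ {P s t} → Path P s t → Path P t s
  reverse-path (one p)      = one p
  reverse-path (cons p e π) = reverse-path π ++ᵖ cons (head-path π) (~-sym e) (one p)

  -- Cutting at the first visit to `t` yields a neighbour of `t` and a path to it that avoids `t`,
  -- the form in which `no-detour` consumes paths.
  before-arrival : ∀ {P s t} → Path P s t → s ≢ t →
    ∃ λ t′ → t′ ~ t × Path (λ u → P u × u ≢ t) s t′
  before-arrival (one p) s≢t = ⊥-elim (s≢t refl)
  before-arrival {t = t} (cons {x = x} p e π) s≢t with x Fin.≟ t
  ... | yes refl = _ , e , one (p , s≢t)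
  ... | no x≢t with before-arrival π x≢t
  ...   | t′ , e′ , π′ = t′ , e′ , cons (p , s≢t) e π′

  data Trail : V → V → ∀ {n} → Vec V (suc n) → Set where
    stop : ∀ {t} → Trail t t (t ∷ [])
    step : ∀ {s x t n} {xs : Vec V (suc n)} → s ~ x → Trail x t xs → Trail s t (s ∷ xs)

  record Simple (P : V → Set) (s t : V) : Set where
    constructor simple
    field
      {len}  : ℕ
      {xs}   : Vec V (suc len)
      trail  : Trail s t xs
      all    : Allᵛ P xs
      unique : Uniqueᵛ xs

  suffix : ∀ {P s x t n} {xs : Vec V (suc n)} →
    s ∈ᵛ xs → Trail x t xs → Allᵛ P xs → Uniqueᵛ xs → Simple P s t
  suffix (here refl)   stop         ps u = simple stop ps u
  suffix (here refl)   (step e tr)  ps u = simple (step e tr) ps u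
  suffix (there s∈xs)  (step e tr)  (_ ∷ ps) (_ ∷ u) = suffix s∈xs tr ps u

  open VecMembership (Fin._≟_ {order}) using () renaming (_∈?_ to _∈ᵛ?_)

  ∉⇒All≢ : ∀ {n} {s : V} (xs : Vec V n) → ¬ (s ∈ᵛ xs) → Allᵛ (s ≢_) xs
  ∉⇒All≢ []       _    = []
  ∉⇒All≢ (x ∷ xs) s∉xs = (s∉xs ∘ here) ∷ ∉⇒All≢ xs (s∉xs ∘ there)

  loop-erase : ∀ {P s t} → Path P s t → Simple P s t
  loop-erase (one p) = simple stop (p ∷ []) ([] ∷ [])
  loop-erase {s = s} (cons p e π) with loop-erase π
  ... | simple {xs = xs} tr ps u with s ∈ᵛ? xs
  ...   | yes s∈xs = suffix s∈xs tr ps u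
  ...   | no s∉xs  = simple (step e tr) (p ∷ ps) (∉⇒All≢ xs s∉xs ∷ u)

  trail-head : ∀ {s t n} {xs : Vec V (suc n)} → Trail s t xs → Vec.lookup xs zero ≡ s
  trail-head stop       = refl
  trail-head (step _ _) = refl

  trail-last : ∀ {s t n} {xs : Vec V (suc n)} → Trail s t xs → Vec.lookup xs (Fin.fromℕ n) ≡ t
  trail-last stop        = refl
  trail-last (step _ tr) = trail-last tr

  trail-step : ∀ {s t n} {xs : Vec V (suc n)} → Trail s t xs →
    ∀ i → Vec.lookup xs (inject₁ i) ~ Vec.lookup xs (suc i)
  trail-step (step {s} e tr) zero    = subst (s ~_) (sym (trail-head tr)) e
  trail-step (step _ tr)     (suc i) = trail-step tr i

  -- After loop erasure the path has at least two vertices, since its ends differ; prefixing `v`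
  -- gives a cycle.
  no-detour : Acyclic → ∀ {v s t} → v ~ s → v ~ t → s ≢ t → ¬ Path (_≢ v) s t
  no-detour acyclic {v} {s} {t} v~s v~t s≢t π with loop-erase π
  ... | simple stop _ _ = s≢t refl
  ... | simple {suc m} {xs} tr ps u = acyclic m record
    { vertex   = Vec.lookup (v ∷ xs)
    ; distinct = lookup-injectiveᵛ (Allᵛ.map (λ x≢v v≡x → x≢v (sym v≡x)) ps ∷ u) _ _
    ; step     = edge
    ; close    = subst (_~ v) (sym (trail-last tr)) (~-sym v~t)
    }
    where
    edge : ∀ i → Vec.lookup (v ∷ xs) (inject₁ i) ~ Vec.lookup (v ∷ xs) (suc i)
    edge zero    = subst (v ~_) (sym (trail-head tr)) v~s
    edge (suc i) = trail-step tr i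

-- Visibility along one axis

private variable
  ℓ₁ ℓ₂ : Level

infixl 1 _>>=_

-- The `do` blocks below work in the double-negation monad: a line `pattern ← em` is a classical
-- case split whose other case stands in the `where` clause.
_>>=_ : {P : Set ℓ₁} {Q : Set ℓ₂} → ¬ ¬ P → (P → ¬ ¬ Q) → ¬ ¬ Q
(m >>= f) k = m λ x → f x k

return : {P : Set ℓ₁} → P → ¬ ¬ P
return x k = k x

em : {P : Set ℓ₁} → ¬ ¬ Dec P
em = ¬¬-excluded-middle

cases : {P : Set ℓ₁} {Q : Set ℓ₂} → (P → ¬ ¬ Q) → (¬ P → ¬ ¬ Q) → ¬ ¬ Q
cases f g k = g (λ p → f p k) k

common-point : ∀ {x y} → x ≺ y ⁺ → y ≺ x ⁺ →
  ¬ ¬ (∃ λ p → (x ≺ p × p ≺ x ⁺) × (y ≺ p × p ≺ y ⁺))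
common-point {x} {y} x<y⁺ y<x⁺ = do
  yes x<y ← em {P = x ≺ y}
    where no x≮y → let (p , x<p , p<y⁺) = ≺-dense x<y⁺ in
                   return (p , (x<p , ≺-≼-trans p<y⁺ (⁺-mono-≼ x≮y)) , (≼-≺-trans x≮y x<p , p<y⁺))
  let (p , y<p , p<x⁺) = ≺-dense y<x⁺
  return (p , (≺-trans x<y y<p , p<x⁺) , (y<p , ≺-trans p<x⁺ (⁺-mono-≺ x<y)))

-- A finite minimum capped by `hi`. Applied to the bottom and top edges of squares it gives a strip
-- just above `lo` in which no edge occurs.
next-value : ∀ {m} (f : Fin m → ℝ) {lo hi} → lo ≺ hi →
  ¬ ¬ (∃ λ nx → lo ≺ nx × nx ≼ hi × ∀ i → lo ≺ f i → nx ≼ f i)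
next-value {zero}  f {lo} {hi} lo<hi = return (hi , lo<hi , ≺-irrefl , λ ())
next-value {suc m} f {lo} {hi} lo<hi = do
  nx , lo<nx , nx≤hi , least ← next-value (f ∘ suc) lo<hi
  yes (lo<f0 , f0<nx) ← em {P = lo ≺ f zero × f zero ≺ nx}
    where no ≮ → return (nx , lo<nx , nx≤hi ,
                   λ { zero lo<f0 f0<nx → ≮ (lo<f0 , f0<nx) ; (suc i) → least i })
  return (f zero , lo<f0 , ≼-trans (≺⇒≼ f0<nx) nx≤hi ,
    λ { zero _ → ≺-irrefl ; (suc i) lo<fi → ≼-trans (≺⇒≼ f0<nx) (least i lo<fi) })

data Sign : Set where
  − ＋ : Sign

opposite : Sign → Sign
opposite −  = ＋
opposite ＋ = −

opposite-involutive : ∀ σ → opposite (opposite σ) ≡ σ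
opposite-involutive −  = refl
opposite-involutive ＋ = refl

module Rows (G : Graph) (S : Graph.V G → Point) (disj : InteriorsDisjoint S) where
  open Graph G
  open GraphPaths G

  X Y : V → ℝ
  X v = proj₁ (S v)
  Y v = proj₂ (S v)

  Overlap : V → V → Set
  Overlap u w = Y u ≺ Y w ⁺ × Y w ≺ Y u ⁺

  -- v meets the lines slightly above the height h.
  Covers : ℝ → V → Set
  Covers h v = Y v ≼ h × h ≺ Y v ⁺

  Overlap-sym : ∀ {u w} → Overlap u w → Overlap w u
  Overlap-sym (p , q) = q , p

  interior : ∀ {v p q} → (X v ≺ p × p ≺ X v ⁺) × (Y v ≺ q × q ≺ Y v ⁺) → Interior (S v) (p , q)
  interior {v} {p} {q} ((a , b) , (c , d)) =
    (≺→<ℝ (X v) p a , ≺-⁺→<ℝ p (X v) b) , (≺→<ℝ (Y v) q c , ≺-⁺→<ℝ q (Y v) d)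

  interior⁻¹ : ∀ v p q → Interior (S v) (p , q) → (X v ≺ p × p ≺ X v ⁺) × (Y v ≺ q × q ≺ Y v ⁺)
  interior⁻¹ v p q ((a , b) , (c , d)) =
    (<ℝ→≺ (X v) p a , <ℝ→≺-⁺ p (X v) b) , (<ℝ→≺ (Y v) q c , <ℝ→≺-⁺ q (Y v) d)

  separated : ∀ {u w} → u ≢ w → Overlap u w → ¬ ¬ (X u ⁺ ≼ X w ⊎ X w ⁺ ≼ X u)
  separated {u} {w} u≢w (yu , yw) k =
    k $ inj₁ λ xw → k $ inj₂ λ xu →
    common-point xu xw λ (p , pu , pw) →
    common-point yu yw λ (q , qu , qw) →
    disj u w u≢w (p , q) (interior (pu , qu) , interior (pw , qw))

  band⇒overlap : ∀ {u w} → HorizontalBand S u w → Overlap u w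
  band⇒overlap {u} {w} (a , b , a<b , vis) =
    let (y , a<y , y<b) = ≺-dense (<ℝ→≺ a b a<b)
        ((p , pu) , (q , qw) , _) = vis y (≺→<ℝ a y a<y) (≺→<ℝ y b y<b)
        (_ , u<y , y<u⁺) = interior⁻¹ u p y pu
        (_ , w<y , y<w⁺) = interior⁻¹ w q y qw
    in ≺-trans u<y y<w⁺ , ≺-trans w<y y<u⁺

  covers⇒overlap : ∀ {h u w} → Covers h u → Covers h w → Overlap u w
  covers⇒overlap (u≤h , h<u⁺) (w≤h , h<w⁺) = ≼-≺-trans u≤h h<w⁺ , ≼-≺-trans w≤h h<u⁺

  -- The band is the strip from `h` up to the next bottom or top edge. A square that meets this
  -- strip cannot begin inside it, so it already covers `h`, and `clear` applies to it.
  band : ∀ {h s t} → Covers h s → Covers h t → X s ≺ X t → X s ⁺ ≼ X t →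
    (∀ u → Covers h u → X s ≺ X u → X u ≺ X t → ⊥) → ¬ ¬ HorizontalBand S s t
  band {h} {s} {t} (s≤h , h<s⁺) (t≤h , h<t⁺) s<t s⁺≤t clear = do
    b₁ , h<b₁ , b₁≤s⁺ , least₁ ← next-value Y h<s⁺
    b , h<b , b≤b₁ , least ← next-value (λ u → Y u ⁺) h<b₁
    ms ← x≺x⁺ (X s)
    mt ← x≺x⁺ (X t)
    let (p , s<p , p<s⁺) = ≺-dense ms
        (q , t<q , q<t⁺) = ≺-dense mt
    return (h , b , ≺→<ℝ h b h<b , λ y h<y′ y<b′ →
      let h<y = <ℝ→≺ h y h<y′
          y<b = <ℝ→≺ y b y<b′
      in (p , interior ((s<p , p<s⁺) , ≼-≺-trans s≤h h<y , ≺-≼-trans y<b (≼-trans b≤b₁ b₁≤s⁺)))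
       , (q , interior ((t<q , q<t⁺) , ≼-≺-trans t≤h h<y , ≺-≼-trans y<b (least t h<t⁺)))
       , λ { r (inj₁ (s⁺≤r , r≤t)) u _ _ int →
               let ((u<r , r<u⁺) , (u<y , y<u⁺)) = interior⁻¹ u r y int in
               clear u ( (λ h<u → ≼-trans b≤b₁ (least₁ u h<u) (≺-trans u<y y<b))
                       , ≺-trans h<y y<u⁺)
                 (⁺-cancel-≺ (≼-≺-trans (λ r<s⁺ → s⁺≤r (≺-⁺→<ℝ r (X s) r<s⁺)) r<u⁺))
                 (≺-≼-trans u<r (λ t<r → r≤t (≺→<ℝ (X t) r t<r)))
           ; r (inj₂ (t⁺≤r , r≤s)) u _ _ int → x≺x⁺ (X t) λ t<t⁺ →
               ≺-irrefl (≺-trans (≺-≼-trans t<t⁺ (≼-trans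
                 (λ r<t⁺ → t⁺≤r (≺-⁺→<ℝ r (X t) r<t⁺))
                 (λ s<r → r≤s (≺→<ℝ (X s) r s<r)))) s<t) })

  Before : Sign → V → V → Set
  Before − u w  = X w ≺ X u
  Before ＋ u w = X u ≺ X w

  module Forks
    (acyclic : Acyclic)
    (adj : ∀ {u w} → u ≢ w → HorizontalBand S u w → u ~ w) where

    -- Recursion on the candidates `us` for squares strictly between `s` and `t`. A candidate that
    -- really lies between splits the problem, and neither half can contain it again; with no
    -- candidates left, `s` and `t` see each other.
    route-via : ∀ {h s t} (us : List V) → Covers h s → Covers h t → X s ≺ X t →
      (∀ u → Covers h u → X s ≺ X u → X u ≺ X t → u ∈ us) →
      ¬ ¬ Path (λ u → Covers h u × (u ≡ s ⊎ X s ≺ X u) × (u ≡ t ⊎ X u ≺ X t)) s t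
    route-via {h} {s} {t} [] hs ht s<t mem = do
      inj₁ s⁺≤t ← separated s≢t (covers⇒overlap hs ht)
        where inj₂ t⁺≤s → λ _ → x≺x⁺ (X t) λ t<t⁺ →
                          ≺-irrefl (≺-trans s<t (≺-≼-trans t<t⁺ t⁺≤s))
      b ← band hs ht s<t s⁺≤t λ u hu s<u u<t → case-∉ (mem u hu s<u u<t)
      return (cons (hs , inj₁ refl , inj₂ s<t) (adj s≢t b) (one (ht , inj₂ s<t , inj₁ refl)))
      where
      s≢t : s ≢ t
      s≢t refl = ≺-irrefl s<t
      case-∉ : ∀ {u : V} → ¬ (u ∈ [])
      case-∉ ()
    route-via {h} {s} {t} (v ∷ us) hs ht s<t mem = do
      yes (hv , s<v , v<t) ← em {P = Covers h v × X s ≺ X v × X v ≺ X t}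
        where no outside → route-via us hs ht s<t λ u hu s<u u<t →
                drop (λ { refl → outside (hu , s<u , u<t) }) (mem u hu s<u u<t)
      π ← route-via us hs hv s<v λ u hu s<u u<v →
            drop (λ { refl → ≺-irrefl u<v }) (mem u hu s<u (≺-trans u<v v<t))
      ρ ← route-via us hv ht v<t λ u hu v<u u<t →
            drop (λ { refl → ≺-irrefl v<u }) (mem u hu (≺-trans s<v v<u) u<t)
      return (map-path (λ { (hu , su , uv) → hu , su , inj₂ (left v<t uv) }) π
         ++ᵖ map-path (λ { (hu , vu , ut) → hu , inj₂ (right s<v vu) , ut }) ρ)
      where
      drop : ∀ {u} → u ≢ v → u ∈ (v ∷ us) → u ∈ us
      drop u≢v (here u≡v) = ⊥-elim (u≢v u≡v)
      drop _   (there u∈) = u∈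
      left : ∀ {u v t} → X v ≺ X t → u ≡ v ⊎ X u ≺ X v → X u ≺ X t
      left v<t (inj₁ refl) = v<t
      left v<t (inj₂ u<v)  = ≺-trans u<v v<t
      right : ∀ {s v u} → X s ≺ X v → u ≡ v ⊎ X v ≺ X u → X s ≺ X u
      right s<v (inj₁ refl) = s<v
      right s<v (inj₂ v<u)  = ≺-trans s<v v<u

    route : ∀ σ {h s t} → Covers h s → Covers h t → Before σ s t →
      ¬ ¬ Path (λ u → Covers h u × (u ≡ s ⊎ Before σ s u) × (u ≡ t ⊎ Before σ u t)) s t
    route ＋ hs ht s<t = route-via (allFin _) hs ht s<t λ u _ _ _ → ∈-allFin u
    route −  hs ht t<s = do
      π ← route ＋ ht hs t<s
      return (reverse-path (map-path (λ (hu , ut , su) → hu , su , ut) π))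

    Before-trans : ∀ σ {u v w} → Before σ u v → Before σ v w → Before σ u w
    Before-trans −  u<v v<w = ≺-trans v<w u<v
    Before-trans ＋ u<v v<w = ≺-trans u<v v<w

    Before-irrefl : ∀ σ {u} → ¬ Before σ u u
    Before-irrefl −  = ≺-irrefl
    Before-irrefl ＋ = ≺-irrefl

    Before-opposite : ∀ σ {u w} → Before σ u w → Before (opposite σ) w u
    Before-opposite −  b = b
    Before-opposite ＋ b = b

    Before-opposite⁻¹ : ∀ σ {u w} → Before (opposite σ) w u → Before σ u w
    Before-opposite⁻¹ −  b = b
    Before-opposite⁻¹ ＋ b = b

    comparable : ∀ {u w} → u ≢ w → Overlap u w → ¬ ¬ (Before ＋ u w ⊎ Before − u w)
    comparable {u} {w} u≢w o = do
      u<u⁺ ← x≺x⁺ (X u)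
      w<w⁺ ← x≺x⁺ (X w)
      s ← separated u≢w o
      return (Sum.map (≺-≼-trans u<u⁺) (≺-≼-trans w<w⁺) s)

    comparable′ : ∀ σ {u w} → u ≢ w → Overlap u w → ¬ ¬ (Before σ u w ⊎ Before σ w u)
    comparable′ ＋ u≢w o = comparable u≢w o
    comparable′ −  u≢w o = comparable u≢w o >>= λ b → return (Sum.swap b)

    -- Forks, legs and edges leading to forks

    Link : Sign → V → V → Set
    Link σ u w = u ~ w × Overlap u w × Before σ u w

    Link-opposite : ∀ σ {u w} → Link σ u w → Link (opposite σ) w u
    Link-opposite σ (e , o , b) = ~-sym e , Overlap-sym o , Before-opposite σ b

    Aligned : V → V → Set
    Aligned u w = Y u ≼ Y w × Y w ≼ Y u

    Aligned-sym : ∀ {u w} → Aligned u w → Aligned w u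
    Aligned-sym (p , q) = q , p

    Aligned-trans : ∀ {u v w} → Aligned u v → Aligned v w → Aligned u w
    Aligned-trans (p , q) (p′ , q′) = ≼-trans p p′ , ≼-trans q′ q

    Overlap-level : ∀ {u v w} → Overlap u v → Aligned v w → Overlap u w
    Overlap-level (p , q) (v≤w , w≤v) = ≺-≼-trans p (⁺-mono-≼ v≤w) , ≼-≺-trans w≤v q

    -- The higher of the two bottom edges works. The last component remembers that `h` is one of
    -- them, which `behind-fork` uses to place `h` below a third square.
    overlap⇒covers : ∀ {u w} → Overlap u w → ¬ ¬ (∃ λ h → Covers h u × Covers h w × (h ≡ Y u ⊎ h ≡ Y w))
    overlap⇒covers {u} {w} (p , q) = do
      u<u⁺ ← x≺x⁺ (Y u)
      w<w⁺ ← x≺x⁺ (Y w)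
      yes w<u ← em {P = Y w ≺ Y u}
        where no u≤w → return (Y w , (u≤w , q) , (≺-irrefl , w<w⁺) , inj₂ refl)
      return (Y u , (≺-irrefl , u<u⁺) , (≺⇒≼ w<u , p) , inj₁ refl)

    -- A line met by both prongs joins the nearer one to the farther one through squares beyond the
    -- nearer one, hence without `v`; this is a detour around `v`.
    prongs-disjoint : ∀ σ {v p q} → Link σ v p → Link σ v q → p ≢ q → ¬ Overlap p q
    prongs-disjoint σ {v} {p} {q} vp vq p≢q o = comparable′ σ p≢q o
      [ blocked vp vq p≢q o , blocked vq vp (p≢q ∘ sym) (Overlap-sym o) ]′
      where
      blocked : ∀ {p q} → Link σ v p → Link σ v q → p ≢ q → Overlap p q → ¬ Before σ p q
      blocked {p} {q} (vp , _ , v<p) (vq , _) p≢q o p<q =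
        overlap⇒covers o λ (h , hp , hq , _) → route σ hp hq p<q λ π →
        no-detour acyclic vp vq p≢q (map-path (λ (_ , pu , _) → avoid pu) π)
        where
        avoid : ∀ {u} → u ≡ p ⊎ Before σ p u → u ≢ v
        avoid (inj₁ refl) refl = Before-irrefl σ v<p
        avoid (inj₂ p<v)  refl = Before-irrefl σ (Before-trans σ v<p p<v)

    prongs-not-above : ∀ σ {v p q} → Link σ v p → Link σ v q → p ≢ q → Y v ≼ Y p → ¬ (Y v ≼ Y q)
    prongs-not-above σ vp@(_ , (_ , p<v⁺) , _) vq@(_ , (_ , q<v⁺) , _) p≢q v≤p v≤q =
      prongs-disjoint σ vp vq p≢q
        (≺-≼-trans p<v⁺ (⁺-mono-≼ v≤q) , ≺-≼-trans q<v⁺ (⁺-mono-≼ v≤p))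

    prongs-not-below : ∀ σ {v p q} → Link σ v p → Link σ v q → p ≢ q → Y p ≼ Y v → ¬ (Y q ≼ Y v)
    prongs-not-below σ vp@(_ , (v<p⁺ , _) , _) vq@(_ , (v<q⁺ , _) , _) p≢q p≤v q≤v =
      prongs-disjoint σ vp vq p≢q (≼-≺-trans p≤v v<q⁺ , ≼-≺-trans q≤v v<p⁺)

    prong-not-level : ∀ σ {v p q} → Link σ v p → Link σ v q → p ≢ q → ¬ Aligned v p
    prong-not-level σ vp vq p≢q (v≤p , p≤v) =
      prongs-not-above σ vp vq p≢q v≤p λ q<v →
      prongs-not-below σ vp vq p≢q p≤v (≺⇒≼ q<v)

    -- Pigeonhole: two of three prongs are both not lower, or both not higher, than `v`, and such
    -- prongs overlap.
    no-three-prongs : ∀ σ {v p q r} → Link σ v p → Link σ v q → Link σ v r →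
      p ≢ q → p ≢ r → q ≢ r → ⊥
    no-three-prongs σ {v} {p} {q} {r} vp vq vr p≢q p≢r q≢r = em {P = Y p ≺ Y v} λ
      { (yes p<v) →
          prongs-not-below σ vp vq p≢q (≺⇒≼ p<v) λ v<q →
          prongs-not-below σ vp vr p≢r (≺⇒≼ p<v) λ v<r →
          prongs-not-above σ vq vr q≢r (≺⇒≼ v<q) (≺⇒≼ v<r)
      ; (no v≤p) →
          prongs-not-above σ vp vq p≢q v≤p λ q<v →
          prongs-not-above σ vp vr p≢r v≤p λ r<v →
          prongs-not-below σ vq vr q≢r (≺⇒≼ q<v) (≺⇒≼ r<v) }

    -- A line missing v joins t to p; together with a line joining t to v and the
    -- edge from v to p it closes a cycle.
    no-bypass : ∀ σ {v p t h} → Link σ v p → Before σ t v → Overlap t v →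
      Covers h t → Covers h p → ¬ Covers h v → ⊥
    no-bypass σ {v} {p} {t} {h} (vp , _ , v<p) t<v o ht hp v∌h =
      overlap⇒covers o λ (h′ , h′t , h′v , _) →
      route σ ht hp (Before-trans σ t<v v<p) λ π →
      route σ h′t h′v t<v λ ρ →
      let (v′ , v′v , ρ′) = before-arrival ρ (λ { refl → Before-irrefl σ t<v })
      in no-detour acyclic (~-sym v′v) vp (not-p (last-path ρ′))
           (reverse-path (map-path proj₂ ρ′) ++ᵖ map-path (λ { (hu , _) refl → v∌h hu }) π)
      where
      not-p : ∀ {k u} → (Covers k u × (u ≡ t ⊎ Before σ t u) × (u ≡ v ⊎ Before σ u v)) × u ≢ v → u ≢ p
      not-p ((_ , _ , inj₁ u≡v) , u≢v) _    = u≢v u≡v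
      not-p ((_ , _ , inj₂ p<v) , _)   refl = Before-irrefl σ (Before-trans σ v<p p<v)

    Fork : Sign → V → Set
    Fork σ v = ∃₂ λ p q → p ≢ q × Link σ v p × Link σ v q

    -- If `t` were higher than `v`, the line just above `v` would join it to any higher prong,
    -- against `no-bypass`; so no prong would be higher, against `prongs-not-below`. The lower case
    -- is symmetric. The conclusion holds at any distance behind `v`, which makes whole legs
    -- straight.
    behind-fork : ∀ σ {v t} → Fork σ v → Before σ t v → Overlap t v → Aligned t v
    behind-fork σ {v} {t} (p , q , p≢q , vp , vq) t<v o@(t<v⁺ , v<t⁺) = not-below , not-above
      where
      above : ∀ {p} → Link σ v p → Y v ≺ Y t → ¬ (Y v ≺ Y p)
      above vp@(_ , (_ , p<v⁺) , _) v<t v<p =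
        no-bypass σ vp t<v o (≺⇒≼ t<v⁺ , ⁺-mono-≺ v<t) (≺⇒≼ p<v⁺ , ⁺-mono-≺ v<p) (≺-irrefl ∘ proj₂)
      below : ∀ {p} → Link σ v p → Y t ≺ Y v → ¬ (Y p ≺ Y v)
      below vp@(_ , (v<p⁺ , _) , _) t<v′ p<v =
        -- The common height is the bottom edge of `t` or of the prong. Both are below the bottom
        -- edge of `v`, so `v` does not cover it.
        overlap⇒covers (≺-trans t<v′ v<p⁺ , ≺-trans p<v v<t⁺) λ
          { (h , ht , hp , inj₁ refl) → no-bypass σ vp t<v o ht hp (λ hv → proj₁ hv t<v′)
          ; (h , ht , hp , inj₂ refl) → no-bypass σ vp t<v o ht hp (λ hv → proj₁ hv p<v) }
      not-below : ¬ (Y v ≺ Y t)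
      not-below v<t = prongs-not-below σ vp vq p≢q (above vp v<t) (above vq v<t)
      not-above : ¬ (Y t ≺ Y v)
      not-above t<v = prongs-not-above σ vp vq p≢q (below vp t<v) (below vq t<v)

    -- An edge out of u that leads away from a fork whose single side it continues.
    LegEdge : Sign → V → V → Set
    LegEdge σ u w = Link σ u w × Aligned u w ×
      ∃ λ f → Fork (opposite σ) f × Before σ f w × Aligned f w

    -- An edge out of u that leads straight to a fork opening away from u.
    TowardsFork : Sign → V → V → Set
    TowardsFork σ u w = Aligned u w ×
      ∃ λ f → Fork σ f × (f ≡ w ⊎ Before σ w f) × Aligned f w

    aligned-unique : ∀ σ {w u x} → Link σ w u → Aligned w u → Link σ w x → x ≡ u
    aligned-unique σ {w} {u} {x} wu w≈u wx with x Fin.≟ u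
    ... | yes x≡u = x≡u
    ... | no x≢u  = ⊥-elim (prong-not-level σ wu wx (x≢u ∘ sym) w≈u)

    -- `x` overlaps `w`, which is level with `f`, and lies behind `f` as well; so `behind-fork` at
    -- `f` itself puts `x` level with `f`.
    leg-extends : ∀ σ {u w x} → LegEdge σ u w → Link σ w x → LegEdge σ w x
    leg-extends σ {u} {w} {x} (_ , _ , f , fork , f<w , f≈w) wx@(_ , o , w<x) =
      wx , Aligned-trans (Aligned-sym f≈w) f≈x , f , fork , f<x , f≈x
      where
      f<x : Before σ f x
      f<x = Before-trans σ f<w w<x
      f≈x : Aligned f x
      f≈x = Aligned-sym (behind-fork (opposite σ) fork (Before-opposite σ f<x)
        (Overlap-level (Overlap-sym o) (Aligned-sym f≈w)))

    leg-behind-fork : ∀ σ {w x} → Fork (opposite σ) w → Link σ w x → LegEdge σ w x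
    leg-behind-fork σ {w} {x} fork wx@(_ , o , w<x) =
      wx , w≈x , w , fork , w<x , w≈x
      where
      w≈x : Aligned w x
      w≈x = Aligned-sym (behind-fork (opposite σ) fork (Before-opposite σ w<x) (Overlap-sym o))

    prong-not-towards : ∀ σ {w u x} → Link σ w u → Link σ w x → x ≢ u → ¬ TowardsFork σ w x
    prong-not-towards σ wu wx x≢u (w≈x , _) = prong-not-level σ wx wu x≢u w≈x

    towards-at-fork : ∀ σ {u w} → Link σ u w → Fork σ w → TowardsFork σ u w
    towards-at-fork σ {u} {w} (_ , o , u<w) fork =
      behind-fork σ fork u<w o , w , fork , inj₁ refl , ≺-irrefl , ≺-irrefl

    -- Used in contrapositive form: an edge that does not lead straight to a fork is not followed,
    -- in the same direction, by one that does.
    towards-extends : ∀ σ {u w x} → Link σ u w → Link σ w x → TowardsFork σ w x → TowardsFork σ u w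
    towards-extends σ {u} {w} {x} (_ , o , u<w) (_ , _ , w<x) (w≈x , f , fork , x≤f , f≈x) =
      Aligned-trans u≈f f≈w , f , fork , inj₂ w<f , f≈w
      where
      w<f : Before σ w f
      w<f = [ (λ { refl → w<x }) , Before-trans σ w<x ]′ x≤f
      f≈w : Aligned f w
      f≈w = Aligned-trans f≈x (Aligned-sym w≈x)
      u≈f : Aligned u f
      u≈f = behind-fork σ fork (Before-trans σ u<w w<f) (Overlap-level o (Aligned-sym f≈w))

    -- This is the exchange: the fork that makes the edge to `x` expensive has `y` behind it too, so
    -- the edge to `y` belongs to the leg of that fork.
    leg-opposite-towards : ∀ σ {w x y} → Link σ w x → TowardsFork σ w x →
      Link (opposite σ) w y → LegEdge (opposite σ) w y
    leg-opposite-towards σ {w} {x} {y} (_ , _ , w<x) (w≈x , f , fork , x≤f , f≈x) wy@(_ , o , w<y) =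
      wy , Aligned-trans (Aligned-sym f≈w) f≈y , f
         , subst (λ τ → Fork τ f) (sym (opposite-involutive σ)) fork
         , Before-opposite σ y<f , f≈y
      where
      w<f : Before σ w f
      w<f = [ (λ { refl → w<x }) , Before-trans σ w<x ]′ x≤f
      f≈w : Aligned f w
      f≈w = Aligned-trans f≈x (Aligned-sym w≈x)
      y<f : Before σ y f
      y<f = Before-trans σ (Before-opposite⁻¹ σ w<y) w<f
      f≈y : Aligned f y
      f≈y = Aligned-sym (behind-fork σ fork y<f (Overlap-level (Overlap-sym o) (Aligned-sym f≈w)))

-- Counting non-backtracking walks

length-⊆ : {A : Set} {xs ys : List A} → Unique xs → (∀ {x} → x ∈ xs → x ∈ ys) → length xs ≤ length ys
length-⊆ {xs = []}     _        _   = z≤n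
length-⊆ {xs = x ∷ xs} {ys} (x∉ ∷ u) xs⊆ with ∈-∃++ (xs⊆ (here refl))
... | as , bs , refl = begin
  suc (length xs)             ≤⟨ s≤s (length-⊆ u λ y∈ → remove y∈ (∈-++⁻ as (xs⊆ (there y∈)))) ⟩
  suc (length (as ++ bs))     ≡⟨ cong suc (length-++ as) ⟩
  suc (length as + length bs) ≡⟨ sym (ℕ.+-suc (length as) (length bs)) ⟩
  length as + suc (length bs) ≡⟨ sym (length-++ as) ⟩
  length (as ++ x ∷ bs)       ∎
  where
  open ℕ.≤-Reasoning
  remove : ∀ {y} → y ∈ xs → y ∈ as ⊎ y ∈ x ∷ bs → y ∈ as ++ bs
  remove y∈ (inj₁ y∈as)           = ∈-++⁺ˡ y∈as
  remove y∈ (inj₂ (here refl))    = ⊥-elim (All.lookup x∉ y∈ refl)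
  remove y∈ (inj₂ (there y∈bs))   = ∈-++⁺ʳ as y∈bs

data Axis : Set where
  hor ver : Axis

cross : Axis → Axis
cross hor = ver
cross ver = hor

-- Bounds for the walks with k further steps: after an edge that does not lead straight to a fork
-- (spine), after an edge of a leg (leg), after any edge leaving a vertex along one axis (fresh).
mutual
  fresh : ℕ → ℕ
  fresh k = spine k + spine k + leg k

  spine : ℕ → ℕ
  spine zero    = 1
  spine (suc k) = fresh k + (leg k + spine k)

  leg : ℕ → ℕ
  leg zero    = 1
  leg (suc k) = fresh k + leg k

-- Both identities go by a joint induction. The first is `leg (suc k) = fresh k + leg k` times four;
-- the second also trades `4 * spine k` for `2 * fresh k` less `2 * leg k`.
a-suc : ∀ k → a (suc k) ≡ 4 * leg k
c-suc : ∀ k → c (suc k) ≡ fresh k + fresh k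
a-suc zero    = refl
a-suc (suc k) rewrite a-suc k | c-suc k = lem (spine k) (leg k)
  where
  lem : ∀ s l → 4 * l + 2 * (s + s + l + (s + s + l)) ≡ 4 * (s + s + l + l)
  lem = solve-∀
c-suc zero    = refl
c-suc (suc k) rewrite a-suc k | c-suc k = lem (spine k) (leg k)
  where
  lem : ∀ s l → 4 * l + 4 * (s + s + l + (s + s + l)) ≡
    s + s + l + (l + s) + (s + s + l + (l + s)) + (s + s + l + l) +
      (s + s + l + (l + s) + (s + s + l + (l + s)) + (s + s + l + l))
  lem = solve-∀

module NonBacktracking (G : Graph) where
  open Graph G
  open DecMembership (Fin._≟_ {order}) using (_∈?_)

  -- u is the vertex visited just before w.
  NB : ℕ → V → V → V → Set
  NB zero    u w z = w ≡ z
  NB (suc k) u w z = ∃ λ x → (w ~ x × x ≢ u) × NB k w x z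

  -- Stepping back to `u` would leave a walk from `u` to `z` that is two steps too short.
  geodesic : ∀ k {u w z} → u ~ w → Walk k w z → (∀ {j} → j ℕ.< suc k → ¬ Walk j u z) → NB k u w z
  geodesic zero    _   w≡z             _     = w≡z
  geodesic (suc k) u~w (x , w~x , walk) short =
    x , (w~x , λ { refl → short (ℕ.m<n⇒m<1+n ℕ.≤-refl) walk })
      , geodesic k w~x walk λ j<k+1 walk′ → short (s≤s j<k+1) (_ , u~w , walk′)

  -- The bound is witnessed by a list of possible end points. The list exists only under a double
  -- negation because the type of an edge, and with it the list, depends on undecidable comparisons.
  Kids : ℕ → V → (V → Set) → ℕ → Set
  Kids k w P m = ¬ ¬ (∃ λ zs → length zs ≤ m × ∀ x z → P x → NB k w x z → z ∈ zs)

  Edge : ℕ → V → V → ℕ → Set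
  Edge k u w m = Kids k u (_≡ w) m

  kids-≤ : ∀ {k w P m n} → m ≤ n → Kids k w P m → Kids k w P n
  kids-≤ m≤n K = do
    zs , l , mem ← K
    return (zs , ℕ.≤-trans l m≤n , mem)

  -- Membership in a list of vertices is decidable, hence stable, so an inclusion of `Q` in `P`
  -- under double negation is enough.
  kids-⊆ : ∀ {k w P Q m} → (∀ {x} → Q x → ¬ ¬ P x) → Kids k w P m → Kids k w Q m
  kids-⊆ Q⊆P K = do
    zs , l , mem ← K
    return (zs , l , λ x z q nb → decidable-stable (z ∈? zs) λ z∉ → Q⊆P q λ p → z∉ (mem x z p nb))

  kids-∪ : ∀ {k w P Q m n} → Kids k w P m → Kids k w Q n → Kids k w (λ x → P x ⊎ Q x) (m + n)
  kids-∪ K K′ = do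
    zs , l , mem ← K
    zs′ , l′ , mem′ ← K′
    return (zs ++ zs′ , ℕ.≤-trans (ℕ.≤-reflexive (length-++ zs)) (ℕ.+-mono-≤ l l′)
      , λ { x z (inj₁ p) nb → ∈-++⁺ˡ (mem x z p nb) ; x z (inj₂ q) nb → ∈-++⁺ʳ zs (mem′ x z q nb) })

  kids-none : ∀ {k w P m} → (∀ {x} → ¬ P x) → Kids k w P m
  kids-none none = return ([] , z≤n , λ _ _ p _ → ⊥-elim (none p))

  kids-one : ∀ {k w P m} → (∀ {x y} → P x → P y → x ≡ y) → (∀ {x} → P x → Edge k w x m) → Kids k w P m
  kids-one {P = P} unique K = do
    yes (x , p) ← em {P = ∃ P}
      where no none → kids-none λ {x} p → none (x , p)
    kids-⊆ (λ q → return (unique q p)) (K p)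

  edge-zero : ∀ {u w m} → 1 ≤ m → Edge 0 u w m
  edge-zero {w = w} 1≤m = return (w ∷ [] , 1≤m , λ { _ _ refl refl → here refl })

  edge-suc : ∀ {k u w m} → Kids k w (λ x → w ~ x × x ≢ u) m → Edge (suc k) u w m
  edge-suc K = do
    zs , l , mem ← K
    return (zs , l , λ { _ z refl (x , px , nb) → mem x z px nb })

-- Weights of edges in a visibility tree

module UpperBound (G : Graph) (acyclic : Graph.Acyclic G) (urvg : IsURVG G) where
  open Graph G
  open IsURVG urvg
  open NonBacktracking G

  at : Axis → V → Point
  at hor = square
  at ver = swap ∘ square

  disjoint-at : ∀ α → InteriorsDisjoint (at α)
  disjoint-at hor = disjoint
  disjoint-at ver v w v≢w (p , q) (iv , iw) = disjoint v w v≢w (q , p) (swap iv , swap iw)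

  adjacent-at : ∀ α {u w} → u ≢ w → HorizontalBand (at α) u w → u ~ w
  adjacent-at hor u≢w b = Equivalence.from (adjacent _ _ u≢w) (inj₁ b)
  adjacent-at ver u≢w b = Equivalence.from (adjacent _ _ u≢w) (inj₂ b)

  module R (α : Axis) = Rows G (at α) (disjoint-at α)
  module F (α : Axis) = R.Forks α acyclic (adjacent-at α)
  open F using (Link; Link-opposite; Fork; LegEdge; TowardsFork)

  ~⇒≢ : ∀ {u w} → u ~ w → u ≢ w
  ~⇒≢ u~w u≡w = ~-irr u≡w u~w

  Along : Axis → V → V → Set
  Along α w x = Link α ＋ w x ⊎ Link α − w x

  along : ∀ α {u w} → u ~ w → HorizontalBand (at α) u w → ¬ ¬ Along α u w
  along α {u} {w} u~w b = do
    let o = R.band⇒overlap α b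
    s ← F.comparable α (~⇒≢ u~w) o
    return (Sum.map (λ u<w → u~w , o , u<w) (λ u<w → u~w , o , u<w) s)

  link : ∀ α {u w} → u ~ w → ¬ ¬ (Along α u w ⊎ Along (cross α) u w)
  link hor u~w with Equivalence.to (adjacent _ _ (~⇒≢ u~w)) u~w
  ... | inj₁ b = along hor u~w b >>= (return ∘ inj₁)
  ... | inj₂ b = along ver u~w b >>= (return ∘ inj₂)
  link ver u~w with Equivalence.to (adjacent _ _ (~⇒≢ u~w)) u~w
  ... | inj₁ b = along hor u~w b >>= (return ∘ inj₂)
  ... | inj₂ b = along ver u~w b >>= (return ∘ inj₁)

  along-sign : ∀ α σ {u w} → Along α u w → Link α σ u w ⊎ Link α (opposite σ) u w
  along-sign α ＋ = id
  along-sign α −  = Sum.swap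

  fork-or-unique : ∀ α σ {w x y} → ¬ Fork α σ w → Link α σ w x → Link α σ w y → x ≡ y
  fork-or-unique α σ {x = x} {y} ¬fork wx wy with x Fin.≟ y
  ... | yes x≡y = x≡y
  ... | no x≢y  = ⊥-elim (¬fork (x , y , x≢y , wx , wy))

  edge-branches : ∀ k α σ {u w m n} →
    Kids k w (Along (cross α) w) (fresh k) →
    Kids k w (Link α σ w) m →
    Kids k w (λ x → Link α (opposite σ) w x × x ≢ u) n →
    Edge (suc k) u w (fresh k + (m + n))
  edge-branches k α σ {u} {w} across forth back =
    edge-suc (kids-⊆ sort (kids-∪ across (kids-∪ forth back)))
    where
    sort : ∀ {x} → w ~ x × x ≢ u → ¬ ¬ (Along (cross α) w x ⊎ Link α σ w x ⊎ Link α (opposite σ) w x × x ≢ u)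
    sort (w~x , x≢u) = do
      inj₁ l ← link α w~x
        where inj₂ l → return (inj₁ l)
      return (inj₂ (Sum.map₂ (_, x≢u) (along-sign α σ l)))

  legs : ∀ k α σ {u w} → LegEdge α σ u w → Edge k u w (leg k)
  -- If `w` has a second neighbour on the side of `u`, these two form a fork: what lies ahead is its
  -- leg, and the other prong starts a spine in the reverse direction. Otherwise only one neighbour
  -- along the axis remains, ahead, because a fork ahead at `w` would make the edge lead to it.
  spines : ∀ k α σ {u w} → Link α σ u w → ¬ TowardsFork α σ u w → Edge k u w (spine k)
  -- Two spines pay for an edge leading straight to a fork. Such an edge is level, so `w` has no
  -- second neighbour on the side of `u`, and the edges ahead weigh at most two spines.
  links : ∀ k α σ {u w} → Link α σ u w → Edge k u w (spine k + spine k)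
  -- With a fork at `w` there are two spines and the leg behind. Without one, an edge leading to a
  -- distant fork weighs at most two spines and faces a leg. In the remaining case there is at most
  -- one spine edge on each side.
  freshes : ∀ k α w → Kids k w (Along α w) (fresh k)

  legs zero    α σ {u} _ = edge-zero {u} ℕ.≤-refl
  legs (suc k) α σ {u} {w} l@(uw , u≈w , _) =
    kids-≤ (ℕ.≤-reflexive (cong (λ n → fresh k + n) (ℕ.+-identityʳ (leg k))))
    (edge-branches k α σ (freshes k (cross α) w)
      (kids-one (λ wx wy → F.aligned-unique α σ wy (aligned wy) wx) (λ wx → legs k α σ (F.leg-extends α σ l wx)))
      (kids-none λ (wx , x≢u) → x≢u (F.aligned-unique α (opposite σ) (Link-opposite α σ uw) (F.Aligned-sym α u≈w) wx)))
    where
    aligned : ∀ {x} → Link α σ w x → F.Aligned α w x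
    aligned wx = proj₁ (proj₂ (F.leg-extends α σ l wx))

  spines zero    α σ {u} _ _ = edge-zero {u} ℕ.≤-refl
  spines (suc k) α σ {u} {w} uw ¬towards = do
    yes fork ← em {P = Fork α (opposite σ) w}
      where no ¬fork → kids-≤
              (ℕ.+-monoʳ-≤ (fresh k) (ℕ.≤-trans (ℕ.≤-reflexive (ℕ.+-identityʳ (spine k))) (ℕ.m≤n+m (spine k) (leg k))))
              (edge-branches k α σ (freshes k (cross α) w)
                (kids-one (fork-or-unique α σ λ fork → ¬towards (F.towards-at-fork α σ uw fork))
                  λ wx → spines k α σ wx λ t → ¬towards (F.towards-extends α σ uw wx t))
                (kids-none λ (wx , x≢u) → ¬fork (_ , _ , x≢u , wx , Link-opposite α σ uw)))
    edge-branches k α σ (freshes k (cross α) w)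
      (kids-one (λ wx wy → F.aligned-unique α σ wy (proj₁ (proj₂ (F.leg-behind-fork α σ fork wy))) wx)
        λ wx → legs k α σ (F.leg-behind-fork α σ fork wx))
      (kids-one unique λ (wx , x≢u) → spines k α (opposite σ) wx
        (F.prong-not-towards α (opposite σ) (Link-opposite α σ uw) wx x≢u))
    where
    unique : ∀ {x y} → Link α (opposite σ) w x × x ≢ u → Link α (opposite σ) w y × y ≢ u → x ≡ y
    unique {x} {y} (wx , x≢u) (wy , y≢u) with x Fin.≟ y
    ... | yes x≡y = x≡y
    ... | no x≢y  = ⊥-elim (F.no-three-prongs α (opposite σ) wx wy (Link-opposite α σ uw) x≢y x≢u y≢u)

  forks : ∀ k α σ {w} → Fork α σ w → Kids k w (Link α σ w) (spine k + spine k)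
  forks k α σ {w} (p , q , p≢q , wp , wq) = kids-⊆ (λ wx → return (either wx)) (kids-∪
    (spines k α σ wp (F.prong-not-towards α σ wq wp p≢q))
    (spines k α σ wq (F.prong-not-towards α σ wp wq (p≢q ∘ sym))))
    where
    either : ∀ {x} → Link α σ w x → x ≡ p ⊎ x ≡ q
    either {x} wx with x Fin.≟ p | x Fin.≟ q
    ... | yes x≡p | _       = inj₁ x≡p
    ... | no _    | yes x≡q = inj₂ x≡q
    ... | no x≢p  | no x≢q  = ⊥-elim (F.no-three-prongs α σ wx wp wq x≢p x≢q p≢q)

  links zero    α σ {u} _ = edge-zero {u} (s≤s z≤n)
  links (suc k) α σ {u} {w} uw = cases
    (λ towards → kids-≤ arith (edge-branches k α σ (freshes k (cross α) w) forth
      (kids-none λ (wx , x≢u) → x≢u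
        (F.aligned-unique α (opposite σ) (Link-opposite α σ uw) (F.Aligned-sym α (proj₁ towards)) wx))))
    (λ ¬towards → kids-≤ (ℕ.m≤m+n (spine (suc k)) (spine (suc k))) (spines (suc k) α σ uw ¬towards))
    where
    forth : Kids k w (Link α σ w) (spine k + spine k)
    forth = do
      yes fork ← em {P = Fork α σ w}
        where no ¬fork → kids-one (fork-or-unique α σ ¬fork) (links k α σ)
      forks k α σ fork
    arith : fresh k + (spine k + spine k + 0) ≤ spine (suc k) + spine (suc k)
    arith = ℕ.≤-trans (ℕ.m≤m+n _ _) (ℕ.≤-reflexive (lem (spine k) (leg k)))
      where
      lem : ∀ s l → s + s + l + (s + s + 0) + (s + s + l + l + l) ≡ s + s + l + (l + s) + (s + s + l + (l + s))
      lem = solve-∀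

  freshes k α w = kids-⊆ (λ l → return l) (do
    no ¬fork⁺ ← em {P = Fork α ＋ w}
      where yes fork → kids-∪ (forks k α ＋ fork) (straight − (F.leg-behind-fork α − fork))
    no ¬fork⁻ ← em {P = Fork α − w}
      where yes fork → kids-⊆ (return ∘ Sum.swap) (kids-∪ (forks k α − fork) (straight ＋ (F.leg-behind-fork α ＋ fork)))
    no ¬t⁺ ← em {P = ∃ λ x → Link α ＋ w x × TowardsFork α ＋ w x}
      where yes (x , wx , t) → kids-∪ (kids-one (fork-or-unique α ＋ ¬fork⁺) (links k α ＋))
                                      (straight − (F.leg-opposite-towards α ＋ wx t))
    no ¬t⁻ ← em {P = ∃ λ x → Link α − w x × TowardsFork α − w x}
      where yes (x , wx , t) → kids-⊆ (return ∘ Sum.swap) (kids-∪ (kids-one (fork-or-unique α − ¬fork⁻) (links k α −))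
                                      (straight ＋ (F.leg-opposite-towards α − wx t)))
    kids-≤ (ℕ.m≤m+n _ (leg k)) (kids-∪
      (kids-one (fork-or-unique α ＋ ¬fork⁺) λ wx → spines k α ＋ wx λ t → ¬t⁺ (_ , wx , t))
      (kids-one (fork-or-unique α − ¬fork⁻) λ wx → spines k α − wx λ t → ¬t⁻ (_ , wx , t))))
    where
    straight : ∀ σ → (∀ {x} → Link α σ w x → LegEdge α σ w x) → Kids k w (Link α σ w) (leg k)
    straight σ is-leg = kids-one
      (λ wx wy → F.aligned-unique α σ wy (proj₁ (proj₂ (is-leg wy))) wx)
      (λ wx → legs k α σ (is-leg wx))

upper-bound : (T : RootedTree) → IsURVG (RootedTree.graph T) →
  (k : ℕ) → 1 ≤ k → RootedTree.#atDepth T k ≤ c k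
-- The claim compares natural numbers, so it is stable and the double negations can be discharged
-- here.
upper-bound T urvg (suc k) _ = decidable-stable (_ ℕ.≤? _) do
  zs , l , mem ← Kids.kids-⊆ (λ e → U.link hor e)
    (Kids.kids-∪ (U.freshes k hor root) (U.freshes k ver root))
  return (ℕ.≤-trans
    (length-⊆ (Unique.filter⁺ (λ v → isDistance? root v (suc k)) (Unique.allFin⁺ order)) (λ {z} z∈ →
      let (_ , (x , root~x , walk) , short) = ∈-filter⁻ (λ v → isDistance? root v (suc k)) {xs = allFin order} z∈
      in mem _ _ root~x (Kids.geodesic k root~x walk short)))
    (ℕ.≤-trans l (ℕ.≤-reflexive (sym (c-suc k)))))
  where
  open RootedTree T
  module U = UpperBound graph acyclic urvg
  module Kids = NonBacktracking graph

-- Layouts on the half-integer grid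

opaque
  half : ℤ → ℚ
  half i = i ℚ./ 2

  half≃ : ∀ i → ℚ.toℚᵘ (half i) ℚᵘ.≃ ℚᵘ.mkℚᵘ i 1
  half≃ i = ℚ.toℚᵘ-fromℚᵘ (ℚᵘ.mkℚᵘ i 1)

  half-mono : ∀ {i j} → i ℤ.< j → half i ℚ.< half j
  half-mono {i} {j} i<j = ℚ.toℚᵘ-cancel-<
    (ℚᵘ.<-respˡ-≃ (ℚᵘ.≃-sym (half≃ i)) (ℚᵘ.<-respʳ-≃ (ℚᵘ.≃-sym (half≃ j))
      (ℚᵘ.*<* (ℤ.*-monoʳ-<-pos (+ 2) i<j))))

  half-cancel : ∀ {i j} → half i ℚ.< half j → i ℤ.< j
  half-cancel {i} {j} i<j with ℚᵘ.<-respˡ-≃ (half≃ i) (ℚᵘ.<-respʳ-≃ (half≃ j) (ℚ.toℚᵘ-mono-< i<j))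
  ... | ℚᵘ.*<* i2<j2 = ℤ.*-cancelʳ-<-nonNeg (+ 2) i2<j2

  half-+2 : ∀ i → half (i ℤ.+ + 2) ≡ half i ℚ.+ 1ℚ
  half-+2 i = ℚ.toℚᵘ-injective (begin
    ℚ.toℚᵘ (half (i ℤ.+ + 2))    ≈⟨ half≃ (i ℤ.+ + 2) ⟩
    ℚᵘ.mkℚᵘ (i ℤ.+ + 2) 1        ≈⟨ ℚᵘ.*≡* (lem i) ⟩
    ℚᵘ.mkℚᵘ i 1 ℚᵘ.+ ℚᵘ.1ℚᵘ      ≈⟨ ℚᵘ.+-congˡ ℚᵘ.1ℚᵘ (ℚᵘ.≃-sym (half≃ i)) ⟩
    ℚ.toℚᵘ (half i) ℚᵘ.+ ℚᵘ.1ℚᵘ  ≈⟨ ℚᵘ.≃-sym (ℚ.toℚᵘ-homo-+ (half i) 1ℚ) ⟩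
    ℚ.toℚᵘ (half i ℚ.+ 1ℚ)       ∎)
    where
    open import Relation.Binary.Reasoning.Setoid ℚᵘ.≃-setoid
    lem : ∀ i → (i ℤ.+ + 2) ℤ.* + 2 ≡ (i ℤ.* + 1 ℤ.+ + 1 ℤ.* + 2) ℤ.* + 2
    lem = solveℤ-∀

opaque
  unfolding _≺_

  ι : ℤ → ℝ
  ι i = fromℚ (half i)

  ι-mono-≺ : ∀ {i j} → i ℤ.< j → ι i ≺ ι j
  ι-mono-≺ {i} {j} i<j = ℚ.<-dense (half-mono {i} {j} i<j)

  ι-cancel-≺ : ∀ {i j} → ι i ≺ ι j → i ℤ.< j
  ι-cancel-≺ {i} {j} (q , i<q , q<j) = half-cancel {i} {j} (ℚ.<-trans i<q q<j)

  ι⁺≼ : ∀ i → ι i ⁺ ≼ ι (i ℤ.+ + 2)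
  ι⁺≼ i (q , i+2<q , q-1<i) = ℚ.<-irrefl refl (ℚ.<-trans
    (subst (ℚ._< half i ℚ.+ 1ℚ) (//-rightDividesˡ 1ℚ q) (ℚ.+-monoˡ-< 1ℚ q-1<i))
    (subst (ℚ._< q) (half-+2 i) i+2<q))

  ≼ι⁺ : ∀ i → ι (i ℤ.+ + 2) ≼ ι i ⁺
  ≼ι⁺ i (q , i<q-1 , q<i+2) = ℚ.<-irrefl refl (ℚ.<-trans
    (subst (half i ℚ.+ 1ℚ ℚ.<_) (//-rightDividesˡ 1ℚ q) (ℚ.+-monoˡ-< 1ℚ i<q-1))
    (subst (q ℚ.<_) (half-+2 i) q<i+2))

ι-mono-≼ : ∀ {i j} → i ℤ.≤ j → ι i ≼ ι j
ι-mono-≼ i≤j j<i = ℤ.<-irrefl refl (ℤ.≤-<-trans i≤j (ι-cancel-≺ j<i))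

ι-⁺-cancel : ∀ {i j} → ι i ≺ ι j ⁺ → i ℤ.< j ℤ.+ + 2
ι-⁺-cancel i<j⁺ = ι-cancel-≺ (≺-≼-trans i<j⁺ (ι⁺≼ _))

-- Coordinates are counted in half units, so a square has side 2.

Close : ℤ → ℤ → Set
Close i j = i ℤ.< j ℤ.+ + 2 × j ℤ.< i ℤ.+ + 2

Ahead : Sign → ℤ → ℤ → Set
Ahead ＋ i j = i ℤ.+ + 2 ℤ.≤ j
Ahead −  i j = j ℤ.+ + 2 ℤ.≤ i

Ahead⇒¬Close : ∀ σ {i j} → Ahead σ i j → ¬ Close i j
Ahead⇒¬Close ＋ i≪j (_ , j<i+2) = ℤ.<-irrefl refl (ℤ.≤-<-trans i≪j j<i+2)
Ahead⇒¬Close −  j≪i (i<j+2 , _) = ℤ.<-irrefl refl (ℤ.≤-<-trans j≪i i<j+2)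

i<i+1 : ∀ i → i ℤ.< i ℤ.+ + 1
i<i+1 i = subst (ℤ._< i ℤ.+ + 1) (ℤ.+-identityʳ i) (ℤ.+-monoʳ-< i (ℤ.+<+ (s≤s z≤n)))

i+1<i+2 : ∀ i → i ℤ.+ + 1 ℤ.< i ℤ.+ + 2
i+1<i+2 i = ℤ.+-monoʳ-< i (ℤ.+<+ (s≤s (s≤s z≤n)))

i<i+2 : ∀ i → i ℤ.< i ℤ.+ + 2
i<i+2 i = ℤ.<-trans (i<i+1 i) (i+1<i+2 i)

Close-refl : ∀ i → Close i i
Close-refl i = i<i+2 i , i<i+2 i

between-halves : ∀ {i} → ι i ≺ ι (i ℤ.+ + 1) × ι (i ℤ.+ + 1) ≺ ι i ⁺
between-halves {i} = ι-mono-≺ (i<i+1 i) , ≺-≼-trans (ι-mono-≺ (i+1<i+2 i)) (≼ι⁺ i)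

HorizontalBand-sym : ∀ {n} {S : Fin n → Point} {v w} → HorizontalBand S v w → HorizontalBand S w v
HorizontalBand-sym (a , b , a<b , vis) = a , b , a<b , λ y a<y y<b →
  let (iv , iw , clear) = vis y a<y y<b
  in iw , iv , λ p btw u u≢w u≢v → clear p (Sum.swap btw) u u≢v u≢w

record Layout (G : Graph) : Set₁ where
  open Graph G
  field
    coord        : Axis → V → ℤ
    time         : V → ℕ
    time-compare : ∀ {u w} → u ≢ w → time u ℕ.< time w ⊎ time w ℕ.< time u
    Child        : Axis → Sign → V → V → Set
    child-~      : ∀ {α σ u p} → Child α σ u p → u ~ p
    ~-child      : ∀ {u w} → u ~ w → (∃₂ λ α σ → Child α σ u w) ⊎ (∃₂ λ α σ → Child α σ w u)
    child-unique : ∀ {α σ p β τ q u} → Child α σ u p → Child β τ u q → σ ≡ τ × p ≡ q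
    child-time   : ∀ {α σ u p} → Child α σ u p → time p ℕ.< time u
    child-close  : ∀ {α σ u p} → Child α σ u p → Close (coord (cross α) u) (coord (cross α) p)
    -- When u is placed, a square in its row other than its parent is hidden from it by its parent.
    hidden       : ∀ α {u w} → time w ℕ.< time u → Close (coord (cross α) u) (coord (cross α) w) →
      ∃₂ λ σ p → Child α σ u p × Ahead σ (coord α w) (coord α u) ×
        (w ≡ p ⊎ Ahead σ (coord α w) (coord α p) × Ahead σ (coord α p) (coord α u) ×
          (coord (cross α) p ≡ coord (cross α) u ⊎ coord (cross α) p ≡ coord (cross α) w))

-- From a layout to a unit square representation

module FromLayout (G : Graph) (layout : Layout G) where
  open Graph G
  open Layout layout

  at : Axis → V → Point
  at α v = ι (coord α v) , ι (coord (cross α) v)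

  overlap⇒close : ∀ {i j} → ι i ≺ ι j ⁺ × ι j ≺ ι i ⁺ → Close i j
  overlap⇒close (p , q) = ι-⁺-cancel p , ι-⁺-cancel q

  never-both-close : ∀ α {u w} → u ≢ w →
    Close (coord (cross α) u) (coord (cross α) w) → ¬ Close (coord α u) (coord α w)
  never-both-close α {u} {w} u≢w o o′ with time-compare u≢w
  ... | inj₂ w<u = let (σ , _ , _ , ahead , _) = hidden α w<u o in Ahead⇒¬Close σ ahead (swap o′)
  ... | inj₁ u<w = let (σ , _ , _ , ahead , _) = hidden α u<w (swap o) in Ahead⇒¬Close σ ahead o′

  disjoint-at : ∀ α → InteriorsDisjoint (at α)
  disjoint-at α v w v≢w (p , q) (((v<p , p<v) , (v<q , q<v)) , ((w<p , p<w) , (w<q , q<w))) =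
    never-both-close α v≢w
      (overlap⇒close ( meet (coord (cross α) v) (coord (cross α) w) q v<q q<w
                     , meet (coord (cross α) w) (coord (cross α) v) q w<q q<v))
      (overlap⇒close ( meet (coord α v) (coord α w) p v<p p<w
                     , meet (coord α w) (coord α v) p w<p p<v))
    where
    meet : ∀ i j r → ι i <ℝ r → r <ℝ ι j +ℚ 1ℚ → ι i ≺ ι j ⁺
    meet i j r i<r r<j = ≺-trans (<ℝ→≺ (ι i) r i<r) (<ℝ→≺-⁺ r (ι j) r<j)

  module R (α : Axis) = Rows G (at α) (disjoint-at α)

  Separates : Axis → V → V → V → Set
  Separates α z u p = (coord α u ℤ.< coord α z × coord α z ℤ.< coord α p)
                    ⊎ (coord α p ℤ.< coord α z × coord α z ℤ.< coord α u)

  ahead-same-side : ∀ α σ {z u p} → Ahead σ (coord α u) (coord α z) → Ahead σ (coord α p) (coord α z) →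
    ¬ Separates α z u p
  ahead-same-side α ＋ {z} u≪z p≪z (inj₁ (_ , z<p)) = ℤ.<-asym z<p (ℤ.<-≤-trans (i<i+2 _) p≪z)
  ahead-same-side α ＋ {z} u≪z p≪z (inj₂ (_ , z<u)) = ℤ.<-asym z<u (ℤ.<-≤-trans (i<i+2 _) u≪z)
  ahead-same-side α − u≪z p≪z (inj₁ (u<z , _)) = ℤ.<-asym u<z (ℤ.<-≤-trans (i<i+2 _) u≪z)
  ahead-same-side α − u≪z p≪z (inj₂ (p<z , _)) = ℤ.<-asym p<z (ℤ.<-≤-trans (i<i+2 _) p≪z)

  ahead-behind : ∀ α σ {z u p} → Ahead σ (coord α z) (coord α p) → Ahead σ (coord α p) (coord α u) →
    ¬ Separates α z u p
  ahead-behind α ＋ z≪p p≪u (inj₁ (u<z , z<p)) = ℤ.<-asym (ℤ.<-trans u<z z<p) (ℤ.<-≤-trans (i<i+2 _) p≪u)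
  ahead-behind α ＋ z≪p p≪u (inj₂ (p<z , z<u)) = ℤ.<-asym p<z (ℤ.<-≤-trans (i<i+2 _) z≪p)
  ahead-behind α − z≪p p≪u (inj₁ (u<z , z<p)) = ℤ.<-asym z<p (ℤ.<-≤-trans (i<i+2 _) z≪p)
  ahead-behind α − z≪p p≪u (inj₂ (p<z , z<u)) = ℤ.<-asym (ℤ.<-trans p<z z<u) (ℤ.<-≤-trans (i<i+2 _) p≪u)

  -- A square placed after `u` is beyond both `u` and `p`, on the same side since each square has
  -- only one direction. A square placed before `u` is hidden from `u` behind `p`.
  nothing-separates : ∀ α {σ u p z} → Child α σ u p → z ≢ u → z ≢ p →
    Close (coord (cross α) z) (coord (cross α) u) → Close (coord (cross α) z) (coord (cross α) p) →
    ¬ Separates α z u p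
  nothing-separates α {σ} {u} {p} {z} child z≢u z≢p zu zp sep with time-compare z≢u
  ... | inj₂ u<z =
    let (τ , _ , child₁ , u≪z , _) = hidden α u<z zu
        (τ′ , _ , child₂ , p≪z , _) = hidden α (ℕ.<-trans (child-time child) u<z) zp
        τ≡ = proj₁ (child-unique child₂ child₁)
    in ahead-same-side α τ u≪z (subst (λ τ → Ahead τ _ _) τ≡ p≪z) sep
  ... | inj₁ z<u with hidden α z<u (swap zu)
  ...   | τ , p′ , child′ , _ , rest with proj₂ (child-unique child′ child)
  ...     | refl with rest
  ...       | inj₁ z≡p = z≢p z≡p
  ...       | inj₂ (z≪p , p≪u , _) = ahead-behind α τ z≪p p≪u sep

  module _ (α : Axis) where
    open R α using (X; Y; interior; interior⁻¹; band⇒overlap)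

    band-of-strip : ∀ {σ u p} lo hi → Child α σ u p → lo ℤ.< hi →
      coord (cross α) u ℤ.≤ lo → coord (cross α) p ℤ.≤ lo →
      hi ℤ.≤ coord (cross α) u ℤ.+ + 2 → hi ℤ.≤ coord (cross α) p ℤ.+ + 2 →
      HorizontalBand (at α) u p
    band-of-strip {u = u} {p} lo hi child lo<hi u≤lo p≤lo hi≤u hi≤p =
      ι lo , ι hi , ≺→<ℝ (ι lo) (ι hi) (ι-mono-≺ lo<hi) , λ y lo<y y<hi →
      let crosses : ∀ {i} → i ℤ.≤ lo → hi ℤ.≤ i ℤ.+ + 2 → ι i ≺ y × y ≺ ι i ⁺
          crosses {i} i≤lo hi≤i = ≼-≺-trans (ι-mono-≼ i≤lo) (<ℝ→≺ (ι lo) y lo<y)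
                                , ≺-≼-trans (<ℝ→≺ y (ι hi) y<hi) (≼-trans (ι-mono-≼ hi≤i) (≼ι⁺ i))
          (u<y , y<u) = crosses u≤lo hi≤u
          (p<y , y<p) = crosses p≤lo hi≤p
      in (ι (coord α u ℤ.+ + 1) , interior {u} (between-halves {coord α u} , (u<y , y<u)))
       , (ι (coord α p ℤ.+ + 1) , interior {p} (between-halves {coord α p} , (p<y , y<p)))
       , λ x btw z z≢u z≢p int →
         let ((z<x , x<z) , (z<y , y<z)) = interior⁻¹ z x y int in
         nothing-separates α child z≢u z≢p
           (overlap⇒close (≺-trans z<y y<u , ≺-trans u<y y<z))
           (overlap⇒close (≺-trans z<y y<p , ≺-trans p<y y<z))
           (Sum.map (inside x z z<x x<z) (inside x z z<x x<z) btw)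
      where
      inside : ∀ x z {u p} → X z ≺ x → x ≺ X z ⁺ → X u +ℚ 1ℚ ≤ℝ x × x ≤ℝ X p →
        coord α u ℤ.< coord α z × coord α z ℤ.< coord α p
      inside x z {u} {p} z<x x<z⁺ (u⁺≤x , x≤p) =
          ι-cancel-≺ (⁺-cancel-≺ (≼-≺-trans (λ x<u⁺ → u⁺≤x (≺-⁺→<ℝ x (X u) x<u⁺)) x<z⁺))
        , ι-cancel-≺ (≺-≼-trans z<x (λ p<x → x≤p (≺→<ℝ (X p) x p<x)))

    band-of-child : ∀ {σ u p} → Child α σ u p → HorizontalBand (at α) u p
    band-of-child {u = u} {p} child with ℤ.≤-total (coord (cross α) u) (coord (cross α) p) | child-close child
    ... | inj₁ u≤p | _ , p<u+2 = band-of-strip (coord (cross α) p) (coord (cross α) u ℤ.+ + 2) child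
      p<u+2 u≤p ℤ.≤-refl ℤ.≤-refl (ℤ.+-monoˡ-≤ (+ 2) u≤p)
    ... | inj₂ p≤u | u<p+2 , _ = band-of-strip (coord (cross α) u) (coord (cross α) p ℤ.+ + 2) child
      u<p+2 ℤ.≤-refl p≤u (ℤ.+-monoˡ-≤ (+ 2) p≤u) ℤ.≤-refl

    -- A parent `p` other than `w` stands between the two at exactly the height of one of them. So
    -- it meets every line that meets both; the blocking point is taken at the midpoint of `p`.
    later-band : ∀ {u w} → time w ℕ.< time u → HorizontalBand (at α) u w → u ~ w
    later-band {u} {w} w<u bd with hidden α w<u (overlap⇒close (band⇒overlap bd))
    ... | σ , p , child , _ , inj₁ refl = child-~ child
    ... | σ , p , child , _ , inj₂ (w≪p , p≪u , row) = ⊥-elim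
      (let (a , b , a<b , vis) = bd
           (y , a<y , y<b) = ≺-dense (<ℝ→≺ a b a<b)
           ((q , iu) , (r , iw) , clear) = vis y (≺→<ℝ a y a<y) (≺→<ℝ y b y<b)
           (_ , u<y) = interior⁻¹ u q y iu
           (_ , w<y) = interior⁻¹ w r y iw
       in clear (ι (coord α p ℤ.+ + 1)) (between σ w≪p p≪u) p
            (λ { refl → Ahead⇒¬Close σ p≪u (Close-refl _) })
            (λ { refl → Ahead⇒¬Close σ w≪p (Close-refl _) })
            (interior {p} (between-halves {coord α p} , crosses y row u<y w<y)))
      where
      crosses : ∀ y → coord (cross α) p ≡ coord (cross α) u ⊎ coord (cross α) p ≡ coord (cross α) w →
        Y u ≺ y × y ≺ Y u ⁺ → Y w ≺ y × y ≺ Y w ⁺ → Y p ≺ y × y ≺ Y p ⁺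
      crosses y (inj₁ p≡u) u<y w<y = subst (λ i → ι i ≺ y × y ≺ ι i ⁺) (sym p≡u) u<y
      crosses y (inj₂ p≡w) u<y w<y = subst (λ i → ι i ≺ y × y ≺ ι i ⁺) (sym p≡w) w<y
      left : ∀ i j → i ℤ.+ + 2 ℤ.≤ j → ι i +ℚ 1ℚ ≤ℝ ι (j ℤ.+ + 1)
      left i j i≪j l = ι⁺≼ i
        (≼-≺-trans (ι-mono-≼ (ℤ.≤-trans i≪j (ℤ.<⇒≤ (i<i+1 j)))) (<ℝ→≺-⁺ (ι (j ℤ.+ + 1)) (ι i) l))
      right : ∀ i j → i ℤ.+ + 2 ℤ.≤ j → ι (i ℤ.+ + 1) ≤ℝ ι j
      right i j i≪j l = ι-mono-≼ (ℤ.≤-trans (ℤ.<⇒≤ (i+1<i+2 i)) i≪j) (<ℝ→≺ (ι j) (ι (i ℤ.+ + 1)) l)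
      between : ∀ σ → Ahead σ (coord α w) (coord α p) → Ahead σ (coord α p) (coord α u) →
        Between (at α u) (at α w) (ι (coord α p ℤ.+ + 1))
      between ＋ w≪p p≪u = inj₂ (left (coord α w) (coord α p) w≪p , right (coord α p) (coord α u) p≪u)
      between −  p≪w u≪p = inj₁ (left (coord α u) (coord α p) u≪p , right (coord α p) (coord α w) p≪w)

    band⇒~ : ∀ {u w} → u ≢ w → HorizontalBand (at α) u w → u ~ w
    band⇒~ u≢w bd with time-compare u≢w
    ... | inj₂ w<u = later-band w<u bd
    ... | inj₁ u<w = ~-sym (later-band u<w (HorizontalBand-sym {S = at α} bd))

  urvg : IsURVG G
  urvg = record
    { square   = at hor
    ; disjoint = disjoint-at hor
    ; adjacent = λ v w v≢w → mk⇔ (bands v w) [ band⇒~ hor v≢w , band⇒~ ver v≢w ]′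
    }
    where
    some-band : ∀ α {σ v w} → Child α σ v w → HorizontalBand (at hor) v w ⊎ HorizontalBand (at ver) v w
    some-band hor ch = inj₁ (band-of-child hor ch)
    some-band ver ch = inj₂ (band-of-child ver ch)
    bands : ∀ v w → v ~ w → HorizontalBand (at hor) v w ⊎ HorizontalBand (at ver) v w
    bands v w v~w with ~-child v~w
    ... | inj₁ (α , _ , ch) = some-band α ch
    ... | inj₂ (α , _ , ch) = Sum.map (HorizontalBand-sym {S = at hor}) (HorizontalBand-sym {S = at ver}) (some-band α ch)

-- The extremal tree and its layout

data Kind : Set where
  straight rise fall : Kind

Move : Set
Move = Axis × Kind

-- A vertex is the list of moves leading to it from the root, the last move first.
Word : Set
Word = List Move

cross-≢ : ∀ α → α ≢ cross α
cross-≢ hor ()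
cross-≢ ver ()

same-or-cross : ∀ α β → β ≡ α ⊎ β ≡ cross α
same-or-cross hor hor = inj₁ refl
same-or-cross hor ver = inj₂ refl
same-or-cross ver hor = inj₂ refl
same-or-cross ver ver = inj₁ refl

roots : Axis → List Move
roots α = (α , straight) ∷ (α , rise) ∷ (α , fall) ∷ []

continue : Axis → Kind → List Move
continue α straight = (α , straight) ∷ []
continue α κ        = (α , straight) ∷ (α , κ) ∷ []

kids : Word → List Move
kids []            = roots hor ++ roots ver
kids ((α , κ) ∷ _) = continue α κ ++ roots (cross α)

data Valid : Word → Set where
  []  : Valid []
  _∷_ : ∀ {m w} → m ∈ kids w → Valid w → Valid (m ∷ w)

roots-axis : ∀ {α β κ} → (β , κ) ∈ roots α → β ≡ α
roots-axis (here refl)                 = refl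
roots-axis (there (here refl))         = refl
roots-axis (there (there (here refl))) = refl

continues : ∀ {α κ κ′ w} → κ ≢ straight → (α , κ) ∈ kids ((α , κ′) ∷ w) → κ ≡ κ′
continues {α} {κ} {κ′} κ≢ m∈ with ∈-++⁻ (continue α κ′) m∈
... | inj₂ m∈roots = ⊥-elim (cross-≢ α (roots-axis m∈roots))
... | inj₁ m∈cont  = lem κ′ m∈cont
  where
  lem : ∀ κ′ → (α , κ) ∈ continue α κ′ → κ ≡ κ′
  lem straight (here refl)         = refl
  lem rise     (here refl)         = ⊥-elim (κ≢ refl)
  lem rise     (there (here refl)) = refl
  lem fall     (here refl)         = ⊥-elim (κ≢ refl)
  lem fall     (there (here refl)) = refl

digit : Move → ℕ
digit (hor , straight) = 1
digit (hor , rise)     = 2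
digit (hor , fall)     = 3
digit (ver , straight) = 4
digit (ver , rise)     = 5
digit (ver , fall)     = 6

undigit : ℕ → Move
undigit 1 = hor , straight
undigit 2 = hor , rise
undigit 3 = hor , fall
undigit 4 = ver , straight
undigit 5 = ver , rise
undigit _ = ver , fall

undigit-digit : ∀ m → undigit (digit m % 7) ≡ m
undigit-digit (hor , straight) = refl
undigit-digit (hor , rise)     = refl
undigit-digit (hor , fall)     = refl
undigit-digit (ver , straight) = refl
undigit-digit (ver , rise)     = refl
undigit-digit (ver , fall)     = refl

digit>0 : ∀ m → 0 ℕ.< digit m
digit>0 (hor , straight) = s≤s z≤n
digit>0 (hor , rise)     = s≤s z≤n
digit>0 (hor , fall)     = s≤s z≤n
digit>0 (ver , straight) = s≤s z≤n
digit>0 (ver , rise)     = s≤s z≤n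
digit>0 (ver , fall)     = s≤s z≤n

-- The order in which the squares are placed.
stamp : Word → ℕ
stamp []      = 0
stamp (m ∷ w) = digit m + stamp w * 7

stamp-∷ : ∀ m w → stamp w ℕ.< stamp (m ∷ w)
stamp-∷ m w = ℕ.+-mono-<-≤ (digit>0 m) (ℕ.m≤m*n (stamp w) 7)

-- A stamp is a numeral in base 7 with digits 1 to 6. As the digit 0 never occurs, it determines the
-- length of the word too.
stamp-injective : ∀ {u w} → stamp u ≡ stamp w → u ≡ w
stamp-injective {[]}    {[]}     _  = refl
stamp-injective {[]}    {m ∷ w}  eq = ⊥-elim (ℕ.n≮0 (subst (stamp w ℕ.<_) (sym eq) (stamp-∷ m w)))
stamp-injective {m ∷ u} {[]}     eq = ⊥-elim (ℕ.n≮0 (subst (stamp u ℕ.<_) eq (stamp-∷ m u)))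
stamp-injective {m ∷ u} {m′ ∷ w} eq with m≡m′
  where
  m≡m′ : m ≡ m′
  m≡m′ = trans (sym (undigit-digit m)) (trans (cong undigit
    (trans (sym ([m+kn]%n≡m%n (digit m) (stamp u) 7))
      (trans (cong (_% 7) eq) ([m+kn]%n≡m%n (digit m′) (stamp w) 7))))
    (undigit-digit m′))
... | refl = cong (m ∷_) (stamp-injective (ℕ.*-cancelʳ-≡ (stamp u) (stamp w) 7 (ℕ.+-cancelˡ-≡ (digit m) _ _ eq)))

-- A square reached along the other axis counts as lying on the side − of its row.
turn : Kind → Sign → Sign
turn straight σ = σ
turn _        σ = opposite σ

side : Axis → Word → Sign
side α   []              = −
side hor ((hor , κ) ∷ w) = turn κ (side hor w)
side ver ((ver , κ) ∷ w) = turn κ (side ver w)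
side hor ((ver , _) ∷ _) = −
side ver ((hor , _) ∷ _) = −

side-same : ∀ α κ w → side α ((α , κ) ∷ w) ≡ turn κ (side α w)
side-same hor κ w = refl
side-same ver κ w = refl

-- In half units. Consecutive rows of a spine thus overlap, while rows two steps apart, such as
-- those of the two prongs of a fork, at most touch in height.
shift : Kind → ℤ
shift straight = + 0
shift rise     = + 1
shift fall     = -[1+ 0 ]

signed : Sign → ℕ → ℤ
signed ＋ n = + n
signed −  n = ℤ.- + n

-- The first component dominates: it numbers widely spaced strips of the plane.
pos : Axis → Word → ℤ × ℤ
pos α   []                = + 0 , + 0
pos hor u@((hor , _) ∷ _) = signed (side hor u) (stamp u) , + 0
pos ver u@((ver , _) ∷ _) = signed (side ver u) (stamp u) , + 0
pos hor ((ver , κ) ∷ w)   = proj₁ (pos hor w) , shift κ ℤ.+ proj₂ (pos hor w)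
pos ver ((hor , κ) ∷ w)   = proj₁ (pos ver w) , shift κ ℤ.+ proj₂ (pos ver w)

strip offset : Axis → Word → ℤ
strip α w  = proj₁ (pos α w)
offset α w = proj₂ (pos α w)

pos-same : ∀ α κ w → pos α ((α , κ) ∷ w) ≡ (signed (side α ((α , κ) ∷ w)) (stamp ((α , κ) ∷ w)) , + 0)
pos-same hor κ w = refl
pos-same ver κ w = refl

pos-cross : ∀ α κ w → pos (cross α) ((α , κ) ∷ w) ≡ (strip (cross α) w , shift κ ℤ.+ offset (cross α) w)
pos-cross hor κ w = refl
pos-cross ver κ w = refl

∣signed∣ : ∀ σ n → ℤ.∣ signed σ n ∣ ≡ n
∣signed∣ ＋ n       = refl
∣signed∣ −  zero    = refl
∣signed∣ −  (suc n) = refl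

∣strip∣≤stamp : ∀ α w → ℤ.∣ strip α w ∣ ℕ.≤ stamp w
∣strip∣≤stamp α   []              = z≤n
∣strip∣≤stamp hor u@((hor , _) ∷ _) = ℕ.≤-reflexive (∣signed∣ (side hor u) (stamp u))
∣strip∣≤stamp ver u@((ver , _) ∷ _) = ℕ.≤-reflexive (∣signed∣ (side ver u) (stamp u))
∣strip∣≤stamp hor (m@(ver , κ) ∷ w) = ℕ.≤-trans (∣strip∣≤stamp hor w) (ℕ.<⇒≤ (stamp-∷ m w))
∣strip∣≤stamp ver (m@(hor , κ) ∷ w) = ℕ.≤-trans (∣strip∣≤stamp ver w) (ℕ.<⇒≤ (stamp-∷ m w))

∣shift∣≤1 : ∀ κ → ℤ.∣ shift κ ∣ ℕ.≤ 1
∣shift∣≤1 straight = z≤n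
∣shift∣≤1 rise     = s≤s z≤n
∣shift∣≤1 fall     = s≤s z≤n

∣offset∣≤length : ∀ α w → ℤ.∣ offset α w ∣ ℕ.≤ length w
∣offset∣≤length α   []              = z≤n
∣offset∣≤length hor ((hor , _) ∷ _) = z≤n
∣offset∣≤length ver ((ver , _) ∷ _) = z≤n
∣offset∣≤length hor ((ver , κ) ∷ w) = ℕ.≤-trans (ℤ.∣i+j∣≤∣i∣+∣j∣ (shift κ) (offset hor w))
  (ℕ.+-mono-≤ (∣shift∣≤1 κ) (∣offset∣≤length hor w))
∣offset∣≤length ver ((hor , κ) ∷ w) = ℕ.≤-trans (ℤ.∣i+j∣≤∣i∣+∣j∣ (shift κ) (offset ver w))
  (ℕ.+-mono-≤ (∣shift∣≤1 κ) (∣offset∣≤length ver w))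

Further : Sign → ℤ → ℤ → Set
Further ＋ i j = i ℤ.< j
Further −  i j = j ℤ.< i

Further-opposite : ∀ σ {i j} → Further σ i j → Further (opposite σ) j i
Further-opposite ＋ f = f
Further-opposite −  f = f

turn-spine : ∀ {κ} → κ ≢ straight → ∀ σ → turn κ σ ≡ opposite σ
turn-spine {straight} κ≢ σ = ⊥-elim (κ≢ refl)
turn-spine {rise}     _  σ = refl
turn-spine {fall}     _  σ = refl

opposite-≢ : ∀ σ → σ ≢ opposite σ
opposite-≢ ＋ ()
opposite-≢ −  ()

further-signed : ∀ σ i {n} → ℤ.∣ i ∣ ℕ.< n → Further σ i (signed σ n)
further-signed ＋ (+ i)    {n}     i<n = +<+ i<n
further-signed ＋ -[1+ i ] {n}     _   = ℤ.-<+
further-signed −  (+ i)    {suc n} _   = ℤ.-<+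
further-signed −  -[1+ i ] {suc n} i<n = ℤ.-<- (ℕ.s≤s⁻¹ i<n)

-- The new square stands at plus or minus its own stamp, and no strip number exceeds the stamp of
-- its square in absolute value.
newest-is-extreme : ∀ α κ p x → stamp x ℕ.< stamp ((α , κ) ∷ p) →
  Further (side α ((α , κ) ∷ p)) (strip α x) (strip α ((α , κ) ∷ p))
newest-is-extreme α κ p x x<u rewrite cong proj₁ (pos-same α κ p) =
  further-signed (side α ((α , κ) ∷ p)) (strip α x) (ℕ.≤-<-trans (∣strip∣≤stamp α x) x<u)

-- Rows of squares joined along one axis

-- A base is the root or was reached across `α`. Across `α` it therefore stands at plus or minus its
-- stamp with offset 0, and the component grown from it along `α` has a strip of its own.
Base : Axis → Word → Set
Base α []            = ⊤
Base α ((β , _) ∷ _) = β ≡ cross α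

stem : Axis → Kind → ℕ → Word → Word
stem α κ zero    w = w
stem α κ (suc r) w = (α , κ) ∷ stem α κ r w

-- The square number j in row r of the component grown from w along α.
place : Axis → Word → Kind → ℕ → ℕ → Word
place α w κ r j = stem α straight j (stem α κ r w)

data Placed (α : Axis) : Word → Set where
  placed : ∀ w κ r j → Base α w → κ ≢ straight → Placed α (place α w κ r j)

spine-move : ∀ α κ {u} → κ ≢ straight → (α , κ) ∈ kids u → Placed α u → Placed α ((α , κ) ∷ u)
spine-move α κ κ≢ m∈ (placed w κ′ r (suc j) _ _) = ⊥-elim (κ≢ (continues {w = []} κ≢ m∈))
-- Spines of both kinds start at a base, so the kind recorded for it gives way to the kind of the
-- move.
spine-move α κ κ≢ m∈ (placed w κ′ zero zero b _) = placed w κ 1 0 b κ≢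
spine-move α κ κ≢ m∈ (placed w κ′ (suc r) zero b κ′≢) with continues {w = []} κ≢ m∈
... | refl = placed w κ (2 + r) 0 b κ≢

locate : ∀ α {u} → Valid u → Placed α u
-- No spine step has been taken in row 0, and `rise` is just the default kind there.
locate α []               = placed [] rise 0 0 tt λ ()
locate α (_∷_ {β , κ} {u} m∈ v) with same-or-cross α β
locate α (_∷_ {β , κ} {u} m∈ v)        | inj₂ β≡ = placed ((β , κ) ∷ u) rise 0 0 β≡ λ ()
locate α (_∷_ {β , straight} {u} m∈ v) | inj₁ refl with locate α v
... | placed w κ r j b κ≢ = placed w κ r (suc j) b κ≢
locate α (_∷_ {β , rise} {u} m∈ v) | inj₁ refl = spine-move α rise (λ ()) m∈ (locate α v)
locate α (_∷_ {β , fall} {u} m∈ v) | inj₁ refl = spine-move α fall (λ ()) m∈ (locate α v)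

row : Kind → ℕ → ℤ
row κ zero    = + 0
row κ (suc r) = shift κ ℤ.+ row κ r

base-pos : ∀ α w → Base α w → ∃ λ σ → pos (cross α) w ≡ (signed σ (stamp w) , + 0)
base-pos α   []              _    = ＋ , refl
base-pos hor ((.ver , κ) ∷ w) refl = side ver ((ver , κ) ∷ w) , refl
base-pos ver ((.hor , κ) ∷ w) refl = side hor ((hor , κ) ∷ w) , refl

stem-pos : ∀ α κ r w → pos (cross α) (stem α κ r w) ≡ (strip (cross α) w , row κ r ℤ.+ offset (cross α) w)
stem-pos α κ zero    w = cong (strip (cross α) w ,_) (sym (ℤ.+-identityˡ (offset (cross α) w)))
stem-pos α κ (suc r) w = trans (pos-cross α κ (stem α κ r w))
  (cong₂ _,_ (cong proj₁ (stem-pos α κ r w))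
    (trans (cong (λ i → shift κ ℤ.+ i) (cong proj₂ (stem-pos α κ r w))) (sym (ℤ.+-assoc (shift κ) (row κ r) _))))

row-straight : ∀ j → row straight j ≡ + 0
row-straight zero    = refl
row-straight (suc j) = trans (ℤ.+-identityˡ _) (row-straight j)

place-pos : ∀ α w κ r j → Base α w → pos (cross α) (place α w κ r j) ≡ (strip (cross α) w , row κ r)
place-pos α w κ r j b = trans (stem-pos α straight j (stem α κ r w)) (cong₂ _,_
  (cong proj₁ (stem-pos α κ r w))
  (trans (cong (λ i → i ℤ.+ offset (cross α) (stem α κ r w)) (row-straight j)) (trans (ℤ.+-identityˡ _)
    (trans (cong proj₂ (stem-pos α κ r w))
      (trans (cong (λ i → row κ r ℤ.+ i) (cong proj₂ (proj₂ (base-pos α w b)))) (ℤ.+-identityʳ _))))))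

-- The absolute value of the strip number of a base is its stamp, so squares of different components
-- never overlap in height.
base-strip : ∀ α {w w′} → Base α w → Base α w′ → strip (cross α) w ≡ strip (cross α) w′ → w ≡ w′
base-strip α {w} {w′} b b′ eq = stamp-injective (begin
  stamp w                      ≡⟨ sym (abs w b) ⟩
  ℤ.∣ strip (cross α) w ∣      ≡⟨ cong ℤ.∣_∣ eq ⟩
  ℤ.∣ strip (cross α) w′ ∣     ≡⟨ abs w′ b′ ⟩
  stamp w′                     ∎)
  where
  open ≡-Reasoning
  abs : ∀ w → Base α w → ℤ.∣ strip (cross α) w ∣ ≡ stamp w
  abs w b = let (σ , eq) = base-pos α w b in trans (cong (ℤ.∣_∣ ∘ proj₁) eq) (∣signed∣ σ (stamp w))

parity : ℕ → Sign
parity zero    = −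
parity (suc r) = opposite (parity r)

base-side : ∀ α w → Base α w → side α w ≡ −
base-side α []                    _    = refl
base-side hor ((.ver , _) ∷ _) refl = refl
base-side ver ((.hor , _) ∷ _) refl = refl

place-side : ∀ α w κ r j → Base α w → κ ≢ straight → side α (place α w κ r j) ≡ parity r
place-side α w κ r (suc j) b κ≢ = trans (side-same α straight _) (place-side α w κ r j b κ≢)
place-side α w κ (suc r) zero b κ≢ = trans (side-same α κ _)
  (trans (turn-spine κ≢ _) (cong opposite (place-side α w κ r zero b κ≢)))
place-side α w κ zero zero b κ≢ = base-side α w b

data Adjacent : ℕ → ℕ → Set where
  same  : ∀ {r} → Adjacent r r
  above : ∀ {r} → Adjacent r (suc r)
  below : ∀ {r} → Adjacent (suc r) r

Adjacent-suc : ∀ {r s} → Adjacent r s → Adjacent (suc r) (suc s)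
Adjacent-suc same  = same
Adjacent-suc above = above
Adjacent-suc below = below

adjacent-< : ∀ r s → r ℕ.< s + 2 → s ℕ.< r + 2 → Adjacent r s
adjacent-< zero          zero          _ _ = same
adjacent-< zero          (suc zero)    _ _ = above
adjacent-< (suc zero)    zero          _ _ = below
adjacent-< zero          (suc (suc s)) _ (s≤s (s≤s ()))
adjacent-< (suc (suc r)) zero          (s≤s (s≤s ())) _
adjacent-< (suc r)       (suc s)       (s≤s p) (s≤s q) = Adjacent-suc (adjacent-< r s p q)

row-rise : ∀ r → row rise r ≡ + r
row-rise zero    = refl
row-rise (suc r) = cong (λ i → + 1 ℤ.+ i) (row-rise r)

row-fall : ∀ r → row fall r ≡ ℤ.- + r
row-fall zero    = refl
row-fall (suc r) = trans (cong (λ i → -[1+ 0 ] ℤ.+ i) (row-fall r)) (sym (ℤ.neg-distrib-+ (+ 1) (+ r)))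

negate-< : ∀ i j → ℤ.- i ℤ.< ℤ.- j ℤ.+ + 2 → j ℤ.< i ℤ.+ + 2
negate-< i j p = subst₂ ℤ._<_ (left i j) (right i j) (ℤ.+-monoˡ-< (i ℤ.+ j) p)
  where
  left : ∀ i j → ℤ.- i ℤ.+ (i ℤ.+ j) ≡ j
  left = solveℤ-∀
  right : ∀ i j → ℤ.- j ℤ.+ + 2 ℤ.+ (i ℤ.+ j) ≡ i ℤ.+ + 2
  right = solveℤ-∀

rows-opposed : ∀ r s → + r ℤ.< ℤ.- + s ℤ.+ + 2 → (r ≡ 0 ⊎ s ≡ 0) × Adjacent r s
rows-opposed r s p = small r s (ℤ.drop‿+<+ (subst (+ (r + s) ℤ.<_) (eq (+ s)) (ℤ.+-monoˡ-< (+ s) p)))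
  where
  eq : ∀ s → ℤ.- s ℤ.+ + 2 ℤ.+ s ≡ + 2
  eq = solveℤ-∀
  small : ∀ r s → r + s ℕ.< 2 → (r ≡ 0 ⊎ s ≡ 0) × Adjacent r s
  small zero       zero       _ = inj₁ refl , same
  small zero       (suc zero) _ = inj₁ refl , above
  small (suc zero) zero       _ = inj₂ refl , below
  small zero (suc (suc s)) (s≤s (s≤s ()))
  small (suc zero) (suc s) (s≤s (s≤s ()))
  small (suc (suc r)) s (s≤s (s≤s ()))

-- Rows of different kinds have heights of opposite signs, so they are close only if one of them is
-- the common row 0 and the other is at most row 1.
rows-adjacent : ∀ κ κ′ r s → κ ≢ straight → κ′ ≢ straight → Close (row κ r) (row κ′ s) →
  (κ ≡ κ′ ⊎ r ≡ 0 ⊎ s ≡ 0) × Adjacent r s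
rows-adjacent straight _        r s κ≢ _   _ = ⊥-elim (κ≢ refl)
rows-adjacent rise     straight r s _  κ′≢ _ = ⊥-elim (κ′≢ refl)
rows-adjacent fall     straight r s _  κ′≢ _ = ⊥-elim (κ′≢ refl)
rows-adjacent rise rise r s _ _ (p , q) rewrite row-rise r | row-rise s =
  inj₁ refl , adjacent-< r s (ℤ.drop‿+<+ p) (ℤ.drop‿+<+ q)
rows-adjacent fall fall r s _ _ (p , q) rewrite row-fall r | row-fall s =
  inj₁ refl , adjacent-< r s (ℤ.drop‿+<+ (negate-< (+ s) (+ r) q)) (ℤ.drop‿+<+ (negate-< (+ r) (+ s) p))
rows-adjacent rise fall r s _ _ (p , q) rewrite row-rise r | row-fall s =
  let (z , adj) = rows-opposed r s p in inj₂ z , adj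
rows-adjacent fall rise r s _ _ (p , q) rewrite row-fall r | row-rise s =
  let (z , adj) = rows-opposed s r q in inj₂ (Sum.swap z) , flip adj
  where
  flip : ∀ {r s} → Adjacent r s → Adjacent s r
  flip same  = same
  flip above = below
  flip below = above

stem-≤ : ∀ α κ {r s} w → r ℕ.≤ s → stamp (stem α κ r w) ℕ.≤ stamp (stem α κ s w)
stem-≤ α κ {zero}  {zero}  w _ = ℕ.≤-refl
stem-≤ α κ {r}     {suc s} w r≤s with ℕ.m≤n⇒m<n∨m≡n r≤s
... | inj₂ refl      = ℕ.≤-refl
... | inj₁ (s≤s r≤s′) = ℕ.≤-trans (stem-≤ α κ w r≤s′) (ℕ.<⇒≤ (stamp-∷ (α , κ) (stem α κ s w)))

stem-< : ∀ α κ {r s} w → r ℕ.< s → stamp (stem α κ r w) ℕ.< stamp (stem α κ s w)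
stem-< α κ {r} w r<s = ℕ.<-≤-trans (stamp-∷ (α , κ) (stem α κ r w)) (stem-≤ α κ w r<s)

-- Hiding within one component

module Component (α : Axis) (w : Word) (b : Base α w) (κ : Kind) (κ≢ : κ ≢ straight) where

  el : ℕ → ℕ → Word
  el = place α w κ

  x : ℕ → ℕ → ℤ
  x r j = strip α (el r j)

  el-side : ∀ r j → side α (el r j) ≡ parity r
  el-side r j = place-side α w κ r j b κ≢

  base-oldest : ∀ r j → stamp w ℕ.≤ stamp (el r j)
  base-oldest r j = ℕ.≤-trans (stem-≤ α κ {0} {r} w z≤n) (stem-≤ α straight {0} {j} _ z≤n)

  extreme : ∀ r j r′ j′ → stamp (el r′ j′) ℕ.< stamp (el r j) → Further (parity r) (x r′ j′) (x r j)
  extreme r (suc j) r′ j′ older = subst (λ σ → Further σ (x r′ j′) (x r (suc j))) (el-side r (suc j))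
    (newest-is-extreme α straight (el r j) (el r′ j′) older)
  extreme (suc r) zero r′ j′ older = subst (λ σ → Further σ (x r′ j′) (x (suc r) zero)) (el-side (suc r) zero)
    (newest-is-extreme α κ (el r zero) (el r′ j′) older)
  extreme zero zero r′ j′ older = ⊥-elim (ℕ.<⇒≱ older (base-oldest r′ j′))

  -- Whichever of the two squares is newer is extreme on its own side; as the sides are opposite,
  -- both cases give the same order.
  opposed : ∀ r j {r′} j′ → parity r′ ≡ opposite (parity r) → Further (parity r) (x r′ j′) (x r j)
  opposed r j {r′} j′ par with ℕ.<-cmp (stamp (el r′ j′)) (stamp (el r j))
  ... | tri< older _ _ = extreme r j r′ j′ older
  ... | tri≈ _ eq _    = ⊥-elim (opposite-≢ (parity r)
    (trans (sym (el-side r j))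
    (trans (cong (side α) (sym (stamp-injective {el r′ j′} {el r j} eq)))
    (trans (el-side r′ j′) par))))
  ... | tri> _ _ newer = subst (λ σ → Further σ (x r′ j′) (x r j)) (opposite-involutive (parity r))
    (Further-opposite (opposite (parity r))
      (subst (λ σ → Further σ (x r j) (x r′ j′)) par (extreme r′ j′ r j newer)))

  y : ℕ → ℕ → ℤ
  y r j = offset (cross α) (el r j)

  y-row : ∀ r j j′ → y r j ≡ y r j′
  y-row r j j′ = cong proj₂ (trans (place-pos α w κ r j b) (sym (place-pos α w κ r j′ b)))

  Hidden : Word → Word → Set
  Hidden u v = ∃₂ λ κ p → u ≡ (α , κ) ∷ p × Further (side α u) (strip α v) (strip α u) ×
    (v ≡ p ⊎ Further (side α u) (strip α v) (strip α p) × Further (side α u) (strip α p) (strip α u) ×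
      (offset (cross α) p ≡ offset (cross α) u ⊎ offset (cross α) p ≡ offset (cross α) v))

  hide : ∀ κ p v → stamp v ℕ.< stamp ((α , κ) ∷ p) →
    v ≡ p ⊎ Further (side α ((α , κ) ∷ p)) (strip α v) (strip α p) ×
      (offset (cross α) p ≡ offset (cross α) ((α , κ) ∷ p) ⊎ offset (cross α) p ≡ offset (cross α) v) →
    Hidden ((α , κ) ∷ p) v
  hide κ p v older rest = κ , p , refl , newest-is-extreme α κ p v older ,
    Sum.map₂ (λ (f , eq) → f , newest-is-extreme α κ p p (stamp-∷ (α , κ) p) , eq) rest

  -- After a straight move the parent is level with the new square; older squares of the row are
  -- earlier ones of the leg, and `opposed` puts neighbouring rows behind the parent. After a spine
  -- move the only older close squares are in the row of the parent: they are level with the parent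
  -- and extend away from the new square.
  hidden-in : ∀ r j {r′} j′ → Adjacent r r′ → stamp (el r′ j′) ℕ.< stamp (el r j) → Hidden (el r j) (el r′ j′)
  hidden-in r (suc j) {r′} j′ adj older = hide straight (el r j) (el r′ j′) older (behind adj older)
    where
    next : ∀ {v} → Further (parity r) (strip α v) (x r j) → Further (side α (el r (suc j))) (strip α v) (x r j)
    next {v} = subst (λ σ → Further σ (strip α v) (x r j)) (sym (el-side r (suc j)))
    level : offset (cross α) (el r j) ≡ offset (cross α) (el r (suc j))
    level = y-row r j (suc j)
    behind : ∀ {r′} → Adjacent r r′ → stamp (el r′ j′) ℕ.< stamp (el r (suc j)) →
      el r′ j′ ≡ el r j ⊎ Further (side α (el r (suc j))) (x r′ j′) (x r j) ×
        (y r j ≡ y r (suc j) ⊎ y r j ≡ y r′ j′)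
    behind {r′} above        _ = inj₂ (next {el r′ j′} (opposed r j j′ refl) , inj₁ level)
    behind {r′} (below {r′}) _ = inj₂ (next {el r′ j′} (opposed r j j′ (sym (opposite-involutive (parity r′)))) , inj₁ level)
    behind same older with ℕ.<-cmp j′ j
    ... | tri< j′<j _ _ = inj₂ (next {el r j′} (extreme r j r j′ (stem-< α straight _ j′<j)) , inj₁ level)
    ... | tri≈ _ refl _ = inj₁ refl
    ... | tri> _ _ j<j′ = ⊥-elim (ℕ.<⇒≱ older (stem-≤ α straight _ j<j′))
  hidden-in (suc r) zero j′ adj older = hide κ (el r 0) _ older (behind j′ adj older)
    where
    behind : ∀ {r′} j′ → Adjacent (suc r) r′ → stamp (el r′ j′) ℕ.< stamp (el (suc r) 0) →
      el r′ j′ ≡ el r 0 ⊎ Further (side α (el (suc r) 0)) (x r′ j′) (x r 0) ×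
        (y r 0 ≡ y (suc r) 0 ⊎ y r 0 ≡ y r′ j′)
    behind j′ same  older = ⊥-elim (ℕ.<⇒≱ older (stem-≤ α straight {0} {j′} _ z≤n))
    behind j′ above older = ⊥-elim (ℕ.<⇒≱ older
      (ℕ.≤-trans (ℕ.<⇒≤ (stamp-∷ (α , κ) (el (suc r) 0))) (stem-≤ α straight {0} {j′} _ z≤n)))
    behind zero     below _ = inj₁ refl
    behind (suc j″) below _ = inj₂
      ( subst (λ σ → Further σ (x r (suc j″)) (x r 0)) (sym (el-side (suc r) 0))
          (Further-opposite (parity r) (extreme r (suc j″) r 0 (stem-< α straight {0} {suc j″} _ (s≤s z≤n))))
      , inj₂ (y-row r 0 (suc j″)))
  hidden-in zero zero {r′} j′ adj older = ⊥-elim (ℕ.<⇒≱ older (base-oldest r′ j′))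

hidden-word : ∀ α {u v} → Valid u → Valid v → stamp v ℕ.< stamp u →
  strip (cross α) u ≡ strip (cross α) v → Close (offset (cross α) u) (offset (cross α) v) →
  ∃₂ λ κ p → u ≡ (α , κ) ∷ p × Further (side α u) (strip α v) (strip α u) ×
    (v ≡ p ⊎ Further (side α u) (strip α v) (strip α p) × Further (side α u) (strip α p) (strip α u) ×
      (offset (cross α) p ≡ offset (cross α) u ⊎ offset (cross α) p ≡ offset (cross α) v))
hidden-word α vu vv older strips close with locate α vu | locate α vv
... | placed w κ r j b κ≢ | placed w′ κ′ r′ j′ b′ κ′≢
  with base-strip α b b′ (trans (sym (cong proj₁ (place-pos α w κ r j b)))
    (trans strips (cong proj₁ (place-pos α w′ κ′ r′ j′ b′))))
... | refl
  with rows-adjacent κ κ′ r r′ κ≢ κ′≢ (subst₂ Close (cong proj₂ (place-pos α w κ r j b))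
    (cong proj₂ (place-pos α w κ′ r′ j′ b′)) close)
... | inj₁ refl        , adj = Component.hidden-in α w b κ κ≢ r j j′ adj older
-- A square of row 0 is the same word for either kind, so it can be read inside the component of
-- kind `κ′`.
... | inj₂ (inj₁ refl) , adj = Component.hidden-in α w b κ′ κ′≢ 0 j j′ adj older
... | inj₂ (inj₂ refl) , adj = Component.hidden-in α w b κ κ≢ r j j′ adj older

-- The parent relation on words

_≟ᵃ_ : DecidableEquality Axis
hor ≟ᵃ hor = yes refl
hor ≟ᵃ ver = no λ ()
ver ≟ᵃ hor = no λ ()
ver ≟ᵃ ver = yes refl

_≟ᵏ_ : DecidableEquality Kind
straight ≟ᵏ straight = yes refl
straight ≟ᵏ rise     = no λ ()
straight ≟ᵏ fall     = no λ ()
rise     ≟ᵏ straight = no λ ()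
rise     ≟ᵏ rise     = yes refl
rise     ≟ᵏ fall     = no λ ()
fall     ≟ᵏ straight = no λ ()
fall     ≟ᵏ rise     = no λ ()
fall     ≟ᵏ fall     = yes refl

_≟ʷ_ : DecidableEquality Word
_≟ʷ_ = ≡-dec (×-≡-dec _≟ᵃ_ _≟ᵏ_)

ChildWord : Word → Word → Set
ChildWord u p = ∃ λ m → u ≡ m ∷ p

childWord? : ∀ u p → Dec (ChildWord u p)
childWord? []      p = no λ ()
childWord? (m ∷ u) p with u ≟ʷ p
... | yes refl = yes (m , refl)
... | no u≢p   = no λ { (_ , refl) → u≢p refl }

childWord-length : ∀ {u p} → ChildWord u p → length u ≡ suc (length p)
childWord-length (_ , refl) = refl

childWord-unique : ∀ {u p q} → ChildWord u p → ChildWord u q → p ≡ q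
childWord-unique (_ , refl) (_ , refl) = refl

parent-shorter : ∀ {u p} → ChildWord u p → length p ℕ.< length u
parent-shorter u≻p = ℕ.≤-reflexive (sym (childWord-length u≻p))

-- Enumeration of the vertices

grow : Word → List Word
grow w = map (_∷ w) (kids w)

generation : ℕ → List Word
generation zero    = [] ∷ []
generation (suc k) = concatMap grow (generation k)

vertices : ℕ → List Word
vertices zero    = generation zero
vertices (suc k) = generation (suc k) ++ vertices k

∈-grow : ∀ {u w} → u ∈ grow w → ∃ λ m → m ∈ kids w × u ≡ m ∷ w
∈-grow = ∈-map⁻ _

∈-generation : ∀ k {u} → u ∈ generation (suc k) → ∃₂ λ m w → w ∈ generation k × m ∈ kids w × u ≡ m ∷ w
∈-generation k u∈ = find (∈-concatMap⁻ grow u∈)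
  where
  find : ∀ {ws u} → Any (λ w → u ∈ grow w) ws → ∃₂ λ m w → w ∈ ws × m ∈ kids w × u ≡ m ∷ w
  find (here u∈)  = let (m , m∈ , eq) = ∈-grow u∈ in m , _ , here refl , m∈ , eq
  find (there u∈) = let (m , w , w∈ , m∈ , eq) = find u∈ in m , w , there w∈ , m∈ , eq

generation-valid : ∀ k {u} → u ∈ generation k → Valid u
generation-valid zero    (here refl) = []
generation-valid (suc k) u∈ with ∈-generation k u∈
... | m , w , w∈ , m∈ , refl = m∈ ∷ generation-valid k w∈

generation-length : ∀ k {u} → u ∈ generation k → length u ≡ k
generation-length zero    (here refl) = refl
generation-length (suc k) u∈ with ∈-generation k u∈
... | m , w , w∈ , m∈ , refl = cong suc (generation-length k w∈)

∈-vertices : ∀ k {u} → u ∈ vertices k → ∃ λ j → j ℕ.≤ k × u ∈ generation j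
∈-vertices zero    u∈ = zero , z≤n , u∈
∈-vertices (suc k) u∈ with ∈-++⁻ (generation (suc k)) u∈
... | inj₁ u∈g = suc k , ℕ.≤-refl , u∈g
... | inj₂ u∈v = let (j , j≤k , u∈g) = ∈-vertices k u∈v in j , ℕ.m≤n⇒m≤1+n j≤k , u∈g

generation⊆vertices : ∀ k {j u} → j ℕ.≤ k → u ∈ generation j → u ∈ vertices k
generation⊆vertices zero    z≤n u∈ = u∈
generation⊆vertices (suc k) j≤k u∈ with ℕ.m≤n⇒m<n∨m≡n j≤k
... | inj₁ (s≤s j≤k′) = ∈-++⁺ʳ (generation (suc k)) (generation⊆vertices k j≤k′ u∈)
... | inj₂ refl       = ∈-++⁺ˡ u∈

parent-∈ : ∀ k {m w} → (m ∷ w) ∈ vertices k → w ∈ vertices k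
parent-∈ k u∈ with ∈-vertices k u∈
... | zero  , _   , here ()
... | suc j , j<k , u∈g with ∈-generation j u∈g
...   | m , w , w∈ , _ , refl = generation⊆vertices k (ℕ.<⇒≤ j<k) w∈

roots-unique : ∀ α → Unique (roots α)
roots-unique α = ((λ ()) ∷ (λ ()) ∷ []) ∷ ((λ ()) ∷ []) ∷ [] ∷ []

continue-unique : ∀ α κ → Unique (continue α κ)
continue-unique α straight = [] ∷ []
continue-unique α rise     = ((λ ()) ∷ []) ∷ [] ∷ []
continue-unique α fall     = ((λ ()) ∷ []) ∷ [] ∷ []

continue-axis : ∀ {α β κ} κ′ → (β , κ) ∈ continue α κ′ → β ≡ α
continue-axis straight (here refl)         = refl
continue-axis rise     (here refl)         = refl
continue-axis rise     (there (here refl)) = refl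
continue-axis fall     (here refl)         = refl
continue-axis fall     (there (here refl)) = refl

kids-unique : ∀ w → Unique (kids w)
kids-unique [] = Unique.++⁺ (roots-unique hor) (roots-unique ver)
  λ (p , q) → cross-≢ hor (trans (sym (roots-axis p)) (roots-axis q))
kids-unique ((α , κ) ∷ _) = Unique.++⁺ (continue-unique α κ) (roots-unique (cross α))
  λ (p , q) → cross-≢ α (trans (sym (continue-axis κ p)) (roots-axis q))

grow-all-unique : ∀ {ws} → Unique ws → Unique (concatMap grow ws)
grow-all-unique {[]}     _         = []
grow-all-unique {w ∷ ws} (w∉ ∷ u) = Unique.++⁺
  (Unique.map⁺ ∷-injectiveˡ (kids-unique w)) (grow-all-unique u) (λ (p , q) → apart w∉ (∈-grow p) (∈-concatMap⁻ grow q))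
  where
  apart : ∀ {u ws} → All (w ≢_) ws → (∃ λ m → m ∈ kids w × u ≡ m ∷ w) → ¬ Any (λ w → u ∈ grow w) ws
  apart (w≢ ∷ _) (m , _ , refl) (here u∈)  = w≢ (∷-injectiveʳ (proj₂ (proj₂ (∈-grow u∈))))
  apart (_ ∷ w∉) p              (there u∈) = apart w∉ p u∈

generation-unique : ∀ k → Unique (generation k)
generation-unique zero    = [] ∷ []
generation-unique (suc k) = grow-all-unique (generation-unique k)

vertices-unique : ∀ k → Unique (vertices k)
vertices-unique zero    = generation-unique zero
vertices-unique (suc k) = Unique.++⁺ (generation-unique (suc k)) (vertices-unique k) λ (p , q) →
  let (j , j≤k , q′) = ∈-vertices k q in
  ℕ.<-irrefl (trans (sym (generation-length j q′)) (generation-length (suc k) p)) (s≤s j≤k)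

spines-in : List Word → ℕ
spines-in []                         = 0
spines-in ([] ∷ ws)                  = spines-in ws
spines-in (((_ , straight) ∷ _) ∷ ws) = spines-in ws
spines-in (((_ , rise) ∷ _) ∷ ws)     = suc (spines-in ws)
spines-in (((_ , fall) ∷ _) ∷ ws)     = suc (spines-in ws)

grow-count : ∀ ws → All (_≢ []) ws →
  length (concatMap grow ws) ≡ spines-in ws + 4 * length ws ×
  spines-in (concatMap grow ws) ≡ spines-in ws + 2 * length ws
grow-count [] [] = refl , refl
grow-count ([] ∷ ws) (w≢[] ∷ _) = ⊥-elim (w≢[] refl)
grow-count (((_ , straight) ∷ _) ∷ ws) (_ ∷ nonempty) =
  let (n , s) = grow-count ws nonempty in
  trans (cong (λ n → 4 + n) n) (four (spines-in ws) (length ws)) ,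
  trans (cong (λ n → 2 + n) s) (two (spines-in ws) (length ws))
  where
  four : ∀ s n → 4 + (s + 4 * n) ≡ s + 4 * suc n
  four = solve-∀
  two : ∀ s n → 2 + (s + 2 * n) ≡ s + 2 * suc n
  two = solve-∀
grow-count (((_ , rise) ∷ _) ∷ ws) (_ ∷ nonempty) =
  let (n , s) = grow-count ws nonempty in
  trans (cong (λ n → 5 + n) n) (four (spines-in ws) (length ws)) ,
  trans (cong (λ n → 3 + n) s) (two (spines-in ws) (length ws))
  where
  four : ∀ s n → 5 + (s + 4 * n) ≡ suc s + 4 * suc n
  four = solve-∀
  two : ∀ s n → 3 + (s + 2 * n) ≡ suc s + 2 * suc n
  two = solve-∀
grow-count (((_ , fall) ∷ _) ∷ ws) (_ ∷ nonempty) =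
  let (n , s) = grow-count ws nonempty in
  trans (cong (λ n → 5 + n) n) (four (spines-in ws) (length ws)) ,
  trans (cong (λ n → 3 + n) s) (two (spines-in ws) (length ws))
  where
  four : ∀ s n → 5 + (s + 4 * n) ≡ suc s + 4 * suc n
  four = solve-∀
  two : ∀ s n → 3 + (s + 2 * n) ≡ suc s + 2 * suc n
  two = solve-∀

-- Below the root a spine square has five children, three of them reached by spine moves, and a leg
-- square has four, two of them so reached. Counting all squares and spine squares together gives
-- the recursion for `c` and `a`.
generation-count : ∀ k → length (generation (suc k)) ≡ c (suc k) × spines-in (generation (suc k)) ≡ a (suc k)
generation-count zero    = refl , refl
generation-count (suc k) =
  let (n , s) = generation-count k
      (n′ , s′) = grow-count (generation (suc k)) (All.tabulate nonempty)
  in trans n′ (cong₂ (λ s n → s + 4 * n) s n) , trans s′ (cong₂ (λ s n → s + 2 * n) s n)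
  where
  nonempty : ∀ {u} → u ∈ generation (suc k) → u ≢ []
  nonempty u∈ refl = ℕ.0≢1+n (generation-length (suc k) u∈)

lookup-injective : ∀ {A : Set} {xs : List A} → Unique xs → ∀ i j → lookup xs i ≡ lookup xs j → i ≡ j
lookup-injective {xs = x ∷ xs} (x∉ ∷ u) zero    zero    _  = refl
lookup-injective {xs = x ∷ xs} (x∉ ∷ u) zero    (suc j) eq = ⊥-elim (All.lookup x∉ (∈-lookup j) eq)
lookup-injective {xs = x ∷ xs} (x∉ ∷ u) (suc i) zero    eq = ⊥-elim (All.lookup x∉ (∈-lookup i) (sym eq))
lookup-injective {xs = x ∷ xs} (x∉ ∷ u) (suc i) (suc j) eq = cong suc (lookup-injective u i j eq)

-- The tree of valid words of length at most k

module Tree (k : ℕ) where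

  word : Fin (length (vertices k)) → Word
  word = lookup (vertices k)

  word-injective : ∀ {u v} → word u ≡ word v → u ≡ v
  word-injective = lookup-injective (vertices-unique k) _ _

  vertexAt : ∀ {w} → w ∈ vertices k → ∃ λ v → word v ≡ w
  vertexAt w∈ = index w∈ , sym (lookup-index w∈)

  parent : ∀ {u m w} → word u ≡ m ∷ w → ∃ λ p → word p ≡ w
  parent {u} eq = vertexAt (parent-∈ k (subst (_∈ vertices k) eq (∈-lookup u)))

  graph : Graph
  graph = record
    { order = length (vertices k)
    ; _~_   = λ u v → ChildWord (word u) (word v) ⊎ ChildWord (word v) (word u)
    ; _~?_  = λ u v → childWord? (word u) (word v) ⊎-dec childWord? (word v) (word u)
    ; ~-sym = Sum.swap
    ; ~-irr = λ { refl (inj₁ u≻u) → ℕ.<-irrefl refl (parent-shorter u≻u)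
                ; refl (inj₂ u≻u) → ℕ.<-irrefl refl (parent-shorter u≻u) }
    }

  open Graph graph

  root : V
  root = proj₁ (vertexAt (generation⊆vertices k z≤n (here refl)))

  word-root : word root ≡ []
  word-root = proj₂ (vertexAt (generation⊆vertices k z≤n (here refl)))

  _++ʷ_ : ∀ {i j u v w} → Walk i u v → Walk j v w → Walk (i + j) u w
  _++ʷ_ {zero}  refl          ρ = ρ
  _++ʷ_ {suc i} (x , e , π)   ρ = x , e , (π ++ʷ ρ)

  from-root : ∀ w {v} → word v ≡ w → Walk (length w) root v
  from-root [] eq = word-injective (trans word-root (sym eq))
  from-root (m ∷ w) {v} eq =
    let (p , p≡w) = parent eq in
    subst (λ n → Walk n root v) (ℕ.+-comm (length w) 1)
      (from-root w p≡w ++ʷ (v , inj₂ (m , trans eq (cong (m ∷_) (sym p≡w))) , refl))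

  to-root : ∀ w {v} → word v ≡ w → Walk (length w) v root
  to-root [] eq = word-injective (trans eq (sym word-root))
  to-root (m ∷ w) {v} eq =
    let (p , p≡w) = parent eq in
    p , inj₁ (m , trans eq (cong (m ∷_) (sym p≡w))) , to-root w p≡w

  connected : Connected
  connected u v = _ , (to-root (word u) refl ++ʷ from-root (word v) refl)

  -- An edge changes the length of a word by exactly one; from the empty word this makes the length
  -- a lower bound for the distance.
  walk-length : ∀ j {u v} → Walk j u v → length (word v) ℕ.≤ j + length (word u)
  walk-length zero    refl = ℕ.≤-refl
  walk-length (suc j) (x , inj₁ u≻x , π) = ℕ.≤-trans (walk-length j π)
    (ℕ.≤-trans (ℕ.+-monoʳ-≤ j (ℕ.<⇒≤ (parent-shorter u≻x))) (ℕ.n≤1+n _))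
  walk-length (suc j) {u} {v} (x , inj₂ x≻u , π) = ℕ.≤-trans (walk-length j π)
    (ℕ.≤-reflexive (trans (cong (λ n → j + n) (childWord-length x≻u)) (ℕ.+-suc j _)))

  depth : ∀ v → IsDistance root v (length (word v))
  depth v = from-root (word v) refl , λ {j} j< π → ℕ.<⇒≱ j<
    (subst (length (word v) ℕ.≤_) (trans (cong (λ w → j + length w) word-root) (ℕ.+-identityʳ j)) (walk-length j π))

  -- Along a cycle every step after the first step to a child leads to a child again.
  acyclic : Acyclic
  acyclic m cycle = conclude (<-weakInduction Progress start proceed (Fin.fromℕ (suc m)))
    where
    open Cycle cycle
    f : Fin (3 + m) → Word
    f i = word (vertex i)

    f-injective : ∀ {i j} → f i ≡ f j → i ≡ j
    f-injective eq = distinct (word-injective eq)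

    first last : Fin (3 + m)
    first = zero
    last  = Fin.fromℕ (2 + m)

    -- Left: the latest step led to a child, and either the first step led to a parent or all steps
    -- so far went to children. Right: all steps so far went to parents. The first step is
    -- remembered because, if it went to the parent, a closing edge from the parent would identify
    -- the last vertex with the second.
    Progress : Fin (2 + m) → Set
    Progress i =
      (ChildWord (f (suc i)) (f (inject₁ i)) ×
        (ChildWord (f first) (f (suc zero)) ⊎ length (f first) ℕ.< length (f (suc i))))
      ⊎ (length (f (suc i)) ℕ.< length (f first) × ChildWord (f first) (f (suc zero)))

    start : Progress zero
    start with step zero
    ... | inj₁ down = inj₂ (parent-shorter down , down)
    ... | inj₂ up   = inj₁ (up , inj₂ (parent-shorter up))

    suc-inject₁ : ∀ {n} (i : Fin n) → suc (suc i) ≢ inject₁ (inject₁ i)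
    suc-inject₁ (suc i) eq = suc-inject₁ i (Fin.suc-injective eq)

    proceed : ∀ i → Progress (inject₁ i) → Progress (suc i)
    proceed i progress with step (suc i) | progress
    ... | inj₁ down | inj₁ (up , _) = ⊥-elim (suc-inject₁ i (f-injective (childWord-unique down up)))
    ... | inj₁ down | inj₂ (lower , d) = inj₂ (ℕ.<-trans (parent-shorter down) lower , d)
    ... | inj₂ up   | inj₁ (_ , inj₁ d) = inj₁ (up , inj₁ d)
    ... | inj₂ up   | inj₁ (_ , inj₂ l) = inj₁ (up , inj₂ (ℕ.<-trans l (parent-shorter up)))
    ... | inj₂ up   | inj₂ (_ , d) = inj₁ (up , inj₁ d)

    conclude : ¬ Progress (Fin.fromℕ (suc m))
    conclude progress with close | progress
    ... | inj₁ up   | inj₁ (up′ , _) = 0≢inject₁ (f-injective (childWord-unique up up′))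
      where
      0≢inject₁ : ∀ {n} → Fin.zero ≢ inject₁ (Fin.fromℕ (suc n))
      0≢inject₁ ()
    ... | inj₁ up   | inj₂ (lower , _) = ℕ.<-asym lower (parent-shorter up)
    ... | inj₂ down | inj₁ (_ , inj₁ d) = last≢1 (f-injective (childWord-unique down d))
      where
      last≢1 : last ≢ suc zero
      last≢1 ()
    ... | inj₂ down | inj₁ (_ , inj₂ l) = ℕ.<-asym l (parent-shorter down)
    ... | inj₂ down | inj₂ (_ , d) = last≢1 (f-injective (childWord-unique down d))
      where
      last≢1 : last ≢ suc zero
      last≢1 ()

  tree : RootedTree
  tree = record { graph = graph ; root = root ; connected = connected ; acyclic = acyclic }

  generation⊆atDepth : ∀ {w} → w ∈ generation k → w ∈ map word (filter (λ v → isDistance? root v k) (allFin order))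
  generation⊆atDepth {w} w∈ =
    let (v , v≡w) = vertexAt (generation⊆vertices k ℕ.≤-refl w∈) in
    subst (_∈ _) v≡w (∈-map⁺ word (∈-filter⁺ (λ v → isDistance? root v k) (∈-allFin v)
      (subst (IsDistance root v) (trans (cong length v≡w) (generation-length k w∈)) (depth v))))

  generation≤atDepth : length (generation k) ℕ.≤ RootedTree.#atDepth tree k
  generation≤atDepth = ℕ.≤-trans (length-⊆ (generation-unique k) generation⊆atDepth)
    (ℕ.≤-reflexive (length-map word (filter (λ v → isDistance? root v k) (allFin order))))

-- Coordinates for the extremal tree

-- Strips are 2k + 2 half units apart, offsets stay within k of them.
embed : ℕ → ℤ × ℤ → ℤ
embed k (z , i) = (+ k ℤ.+ + k ℤ.+ + 2) ℤ.* z ℤ.+ i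

∣∣≤⇒≤ : ∀ {k} i → ℤ.∣ i ∣ ℕ.≤ k → ℤ.- + k ℤ.≤ i × i ℤ.≤ + k
∣∣≤⇒≤ {k}     (+ n)    n≤k         = ℤ.neg-≤-pos {k} {n} , +≤+ n≤k
∣∣≤⇒≤ {suc k} -[1+ n ] (s≤s n≤k)   = ℤ.-≤- n≤k , ℤ.-≤+

-- Of the spacing 2k + 2, the two offsets use up at most 2k, which leaves the side of a square.
embed-apart : ∀ k {z z′ i i′} → z ℤ.< z′ → ℤ.∣ i ∣ ℕ.≤ k → ℤ.∣ i′ ∣ ℕ.≤ k →
  embed k (z , i) ℤ.+ + 2 ℤ.≤ embed k (z′ , i′)
embed-apart k {z} {z′} {i} {i′} z<z′ i≤k i′≤k = begin
  C ℤ.* z ℤ.+ i ℤ.+ + 2        ≤⟨ ℤ.+-monoˡ-≤ (+ 2) (ℤ.+-monoʳ-≤ (C ℤ.* z) (proj₂ (∣∣≤⇒≤ i i≤k))) ⟩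
  C ℤ.* z ℤ.+ + k ℤ.+ + 2      ≡⟨ lem (+ k) z ⟩
  C ℤ.* (+ 1 ℤ.+ z) ℤ.+ ℤ.- + k ≤⟨ ℤ.+-mono-≤ (ℤ.*-monoˡ-≤-nonNeg C (ℤ.i<j⇒suc[i]≤j z<z′)) (proj₁ (∣∣≤⇒≤ i′ i′≤k)) ⟩
  C ℤ.* z′ ℤ.+ i′              ∎
  where
  open ℤ.≤-Reasoning
  C = + k ℤ.+ + k ℤ.+ + 2
  lem : ∀ k z → (k ℤ.+ k ℤ.+ + 2) ℤ.* z ℤ.+ k ℤ.+ + 2 ≡ (k ℤ.+ k ℤ.+ + 2) ℤ.* (+ 1 ℤ.+ z) ℤ.+ ℤ.- k
  lem = solveℤ-∀

embed-close : ∀ k {z z′ i i′} → ℤ.∣ i ∣ ℕ.≤ k → ℤ.∣ i′ ∣ ℕ.≤ k →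
  Close (embed k (z , i)) (embed k (z′ , i′)) → z ≡ z′ × Close i i′
embed-close k {z} {z′} {i} {i′} i≤k i′≤k (p , q) with ℤ.<-cmp z z′
... | tri< z<z′ _ _ = ⊥-elim (ℤ.<-irrefl refl (ℤ.≤-<-trans (embed-apart k z<z′ i≤k i′≤k) q))
... | tri> _ _ z′<z = ⊥-elim (ℤ.<-irrefl refl (ℤ.≤-<-trans (embed-apart k z′<z i′≤k i≤k) p))
... | tri≈ _ refl _ = refl , cancel i i′ p , cancel i′ i q
  where
  cancel : ∀ i j → embed k (z , i) ℤ.< embed k (z , j) ℤ.+ + 2 → i ℤ.< j ℤ.+ + 2
  cancel i j p = ℤ.≰⇒> λ j+2≤i → ℤ.<⇒≱ p
    (subst (ℤ._≤ embed k (z , i)) (sym (ℤ.+-assoc Cz j (+ 2))) (ℤ.+-monoʳ-≤ Cz j+2≤i))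
    where Cz = (+ k ℤ.+ + k ℤ.+ + 2) ℤ.* z

embed-further : ∀ k σ {z z′ i i′} → ℤ.∣ i ∣ ℕ.≤ k → ℤ.∣ i′ ∣ ℕ.≤ k →
  Further σ z z′ → Ahead σ (embed k (z , i)) (embed k (z′ , i′))
embed-further k ＋ i≤k i′≤k z<z′ = embed-apart k z<z′ i≤k i′≤k
embed-further k −  i≤k i′≤k z′<z = embed-apart k z′<z i′≤k i≤k

shift-close : ∀ κ i → Close (shift κ ℤ.+ i) i
shift-close straight i = subst (λ j → Close j i) (sym (ℤ.+-identityˡ i)) (Close-refl i)
shift-close rise     i = subst (λ j → Close j i) (ℤ.+-comm i (+ 1))
  (i+1<i+2 i , ℤ.<-trans (i<i+1 i) (i<i+2 (i ℤ.+ + 1)))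
shift-close fall     i =
  subst (ℤ._< i ℤ.+ + 2) (ℤ.+-comm i -[1+ 0 ]) (ℤ.+-monoʳ-< i ℤ.-<+) , subst (i ℤ.<_) (lem i) (i<i+1 i)
  where
  lem : ∀ i → i ℤ.+ + 1 ≡ -[1+ 0 ] ℤ.+ i ℤ.+ + 2
  lem = solveℤ-∀

module TreeLayout (k : ℕ) where
  open Tree k
  open Graph graph

  coord : Axis → V → ℤ
  coord α v = embed k (pos α (word v))

  word-valid : ∀ v → Valid (word v)
  word-valid v = let (j , _ , w∈) = ∈-vertices k (∈-lookup v) in generation-valid j w∈

  offset-bound : ∀ α v → ℤ.∣ offset α (word v) ∣ ℕ.≤ k
  offset-bound α v = let (j , j≤k , w∈) = ∈-vertices k (∈-lookup v) in
    ℕ.≤-trans (∣offset∣≤length α (word v)) (ℕ.≤-trans (ℕ.≤-reflexive (generation-length j w∈)) j≤k)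

  Child : Axis → Sign → V → V → Set
  Child α σ u p = ∃ λ κ → word u ≡ (α , κ) ∷ word p × σ ≡ side α (word u)

  time-compare : ∀ {u v} → u ≢ v → stamp (word u) ℕ.< stamp (word v) ⊎ stamp (word v) ℕ.< stamp (word u)
  time-compare {u} {v} u≢v with ℕ.<-cmp (stamp (word u)) (stamp (word v))
  ... | tri< u<v _ _ = inj₁ u<v
  ... | tri> _ _ v<u = inj₂ v<u
  ... | tri≈ _ eq _  = ⊥-elim (u≢v (word-injective (stamp-injective eq)))

  ahead : ∀ α σ u v → Further σ (strip α (word u)) (strip α (word v)) → Ahead σ (coord α u) (coord α v)
  ahead α σ u v = embed-further k σ (offset-bound α u) (offset-bound α v)

  child-unique : ∀ {α σ u p β τ q} → Child α σ u p → Child β τ u q → σ ≡ τ × p ≡ q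
  child-unique {u = u} (κ , eq , refl) (κ′ , eq′ , refl) =
      cong (λ α → side α (word u)) (cong proj₁ (∷-injectiveˡ same-word)) , word-injective (∷-injectiveʳ same-word)
    where same-word = trans (sym eq) eq′

  child-close : ∀ {α σ u p} → Child α σ u p → Close (coord (cross α) u) (coord (cross α) p)
  child-close {α} {u = u} {p} (κ , eq , _) = subst (λ c → Close (embed k c) (coord (cross α) p))
    (sym (trans (cong (pos (cross α)) eq) (pos-cross α κ (word p))))
    (add (strip (cross α) (word p)) (shift-close κ (offset (cross α) (word p))))
    where
    add : ∀ z {i j} → Close i j → Close (embed k (z , i)) (embed k (z , j))
    add z {i} {j} (p , q) = plus i j p , plus j i q
      where
      plus : ∀ i j → i ℤ.< j ℤ.+ + 2 → embed k (z , i) ℤ.< embed k (z , j) ℤ.+ + 2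
      plus i j p = subst (embed k (z , i) ℤ.<_) (sym (ℤ.+-assoc ((+ k ℤ.+ + k ℤ.+ + 2) ℤ.* z) j (+ 2)))
        (ℤ.+-monoʳ-< ((+ k ℤ.+ + k ℤ.+ + 2) ℤ.* z) p)

  hidden : ∀ α {u v} → stamp (word v) ℕ.< stamp (word u) → Close (coord (cross α) u) (coord (cross α) v) →
    ∃₂ λ σ p → Child α σ u p × Ahead σ (coord α v) (coord α u) ×
      (v ≡ p ⊎ Ahead σ (coord α v) (coord α p) × Ahead σ (coord α p) (coord α u) ×
        (coord (cross α) p ≡ coord (cross α) u ⊎ coord (cross α) p ≡ coord (cross α) v))
  hidden α {u} {v} older close =
    let β = cross α
        (strips , offsets) = embed-close k {strip β (word u)} {strip β (word v)}
          (offset-bound β u) (offset-bound β v) close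
        (κ , w , eq , v-u , rest) = hidden-word α (word-valid u) (word-valid v) older strips offsets
        (p , p≡w) = parent {u} eq
        σ = side α (word u)
        strip-p = sym (cong proj₁ (trans (cong (pos β) eq) (pos-cross α κ w)))
        conclude : word v ≡ w ⊎ Further σ (strip α (word v)) (strip α w) × Further σ (strip α w) (strip α (word u)) ×
          (offset β w ≡ offset β (word u) ⊎ offset β w ≡ offset β (word v)) → _
        conclude = λ
          { (inj₁ v≡w) → inj₁ (word-injective (trans v≡w (sym p≡w)))
          ; (inj₂ (v-p , p-u , offs)) → inj₂
              ( ahead α σ v p (subst (λ w → Further σ (strip α (word v)) (strip α w)) (sym p≡w) v-p)
              , ahead α σ p u (subst (λ w → Further σ (strip α w) (strip α (word u))) (sym p≡w) p-u)
              , Sum.map (λ o → cong (embed k) (trans (cong (pos β) p≡w) (cong₂ _,_ strip-p o)))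
                        (λ o → cong (embed k) (trans (cong (pos β) p≡w) (cong₂ _,_ (trans strip-p strips) o)))
                        offs) }
    in σ , p , (κ , trans eq (cong ((α , κ) ∷_) (sym p≡w)) , refl) , ahead α σ v u v-u , conclude rest

  layout : Layout graph
  layout = record
    { coord        = coord
    ; time         = stamp ∘ word
    ; time-compare = time-compare
    ; Child        = Child
    ; child-~      = λ (κ , eq , _) → inj₁ (_ , eq)
    ; ~-child      = Sum.map (λ { ((α , κ) , eq) → α , _ , κ , eq , refl })
                             (λ { ((α , κ) , eq) → α , _ , κ , eq , refl })
    ; child-unique = child-unique
    ; child-time   = λ {α} {σ} {u} {p} (κ , eq , _) →
        subst (λ w → stamp (word p) ℕ.< stamp w) (sym eq) (stamp-∷ (α , κ) (word p))
    ; child-close  = child-close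
    ; hidden       = hidden
    }

theorem6p2 : ((T : RootedTree) → IsURVG (RootedTree.graph T) →
    (k : ℕ) → k ≥ 1 → RootedTree.#atDepth T k ≤ c k)
    × ((k : ℕ) → k ≥ 1 →
    Σ RootedTree (λ T → IsURVG (RootedTree.graph T) × RootedTree.#atDepth T k ≡ c k))
theorem6p2 = upper-bound , λ { (suc k) k≥1 →
  let T = Tree.tree (suc k)
      urvg = FromLayout.urvg (Tree.graph (suc k)) (TreeLayout.layout (suc k))
  -- Only the lower bound is counted in the tree; the upper bound already proved, applied to this
  -- tree, gives equality.
  in T , urvg , ℕ.≤-antisym (upper-bound T urvg (suc k) k≥1)
       (subst (ℕ._≤ RootedTree.#atDepth T (suc k)) (proj₁ (generation-count k)) (Tree.generation≤atDepth (suc k))) }
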